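{- Consider instances of the Colored Knapsack Problem (ColKP) with $n$ items, in which every color class is nonempty, satisfying $w_i\le b$ and $-p_{\max}<p_i\le p_{\max}$ for all items $i\in\mathcal I$, where $p_{\max}=\max\{p_i:i\in\mathcal I\}>0$, and let $\varepsilon\in(0,1)$. The color-by-color scaling algorithm (Algorithm F2 described in the context) runs in $O(n^5/\varepsilon^2)$ time when all profits are nonnegative, and in $O(n^7/\varepsilon^2)$ time for arbitrary integer profits.
   Context: ColKP instance: items $\mathcal I=\{1,\dots,n\}$, capacity $b\in\mathbb Z_{>0}$, colors $\mathcal C=\{1,\dots,m\}$; each item $i$ has weight $w_i\in\mathbb Z_{>0}$, profit $p_i\in\mathbb Z$ and color $\kappa_i\in\mathcal C$. For $S\subseteq\mathcal I$: $w(S)=\sum_{i\in S}w_i$, $p(S)=\sum_{i\in S}p_i$, $\mathcal I_c=\{i\in\mathcal I:\kappa_i=c\}$ (the color class of $c$), $k_c(S)=|S\cap\mathcal I_c|$, $d(S)=\max_{c\in\mathcal C}k_c(S)$. A color $c$ is dominant in $S$ if $k_c(S)=d(S)$. $S$ is color-feasible if $2d(S)\le|S|+1$, and feasible if moreover $w(S)\le b$. The problem asks for a feasible $S$ maximizing $p(S)$. Algorithm LP-Round: (1) compute an optimal basic solution $x^*$ (an optimal extreme point) of the linear program: maximize $\sum_{i}p_ix_i$ subject to $\sum_{i}w_ix_i\le b$, $\sum_{i\in\mathcal I_c}x_i-\sum_{i\in\mathcal I\setminus\mathcal I_c}x_i\le1$ for all $c\in\mathcal C$, $x_i\in[0,1]$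 for all $i$, using a subroutine known from earlier work that does this in $O(n)$ time; (2) set $S_0=\{i:x_i^*=1\}$; (3) if $S_0$ is not color-feasible, let $c$ be its unique dominant color and remove from $S_0$ an item of $S_0\cap\mathcal I_c$ of minimum profit; (4) return the more profitable of $S_0$ and $\{r\}$, where $r$ is an item with $p_r=p_{\max}$. Algorithm F2 (input: the instance and $\varepsilon$): (1) Run LP-Round, let $\mathrm{LB}$ be the profit of the set it returns, and let $\mathrm{UB}=3\,\mathrm{LB}$. (2) Set $\lambda=\varepsilon\,\mathrm{LB}/n$ and $\hat p_i=\lfloor p_i/\lambda\rfloor$ for all $i$. (3) If all $p_i\ge0$, set $z_{\min}=0$, $z_{\max}=\lceil\mathrm{UB}/\lambda\rceil$; otherwise set $z_{\min}=\lfloor -n\,p_{\max}/\lambda\rfloor$, $z_{\max}=\lceil(\mathrm{UB}+n\,p_{\max})/\lambda\rceil$. Let $\mathcal Z=\{z_{\min},z_{\min}+1,\dots,z_{\max}\}$. (4) Inner programs: for each color $c$, compute a table $h_c(k,\zeta)$, $k\in\{0,\dots,|\mathcal I_c|\}$, $\zeta\in\mathcal Z$, by the usual item-by-item knapsack recursion with a cardinality counter: start with $h_c(0,0)=0$ and all other entries $+\infty$, and process the items $i\in\mathcal I_c$ one at a time, each time either not packing $i$ (leaving $(k,\zeta)$ and the weight unchanged) or packing it (moving from $(k,\zeta)$ to $(k+1,\zeta+\hat p_i)$ and adding $w_i$ to the weight), keeping the minimum weight for each pair; a transition is performed only if the resulting profit level lies in $\mathcal Z$ and the resulting weight is at most $b$.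 Let $\mathcal S_c=\{(k,\zeta):h_c(k,\zeta)<+\infty\}$ for the final table. (5) Outer program: set $g(0,0,0,0)=0$ and all other entries $g(c,t,d,z)=+\infty$, for $c\in\{0,\dots,m\}$, $t,d\in\{0,\dots,n\}$, $z\in\mathcal Z$. For $c=1,\dots,m$, for all $(t,d,z)$ with $g(c-1,t,d,z)<+\infty$ and all $(k,\zeta)\in\mathcal S_c$, set $g(c,t+k,\max\{d,k\},z+\zeta)\leftarrow\min\{g(c,t+k,\max\{d,k\},z+\zeta),\,g(c-1,t,d,z)+h_c(k,\zeta)\}$, performed only if $z+\zeta\in\mathcal Z$ and $g(c-1,t,d,z)+h_c(k,\zeta)\le b$. (6) Among all terminal entries with $g(m,t,d,z)\le b$ and $2d\le t+1$, choose one with maximum $z$, and return the set recovered by backtracking through the outer and inner transitions. Running time counts elementary arithmetic operations, comparisons and table accesses.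
   Formalization: The accuracy parameter ε ranges over the rational numbers in (0,1) rather than the real ones; the linear program's variables are likewise rational. -}

module Defs where

open import Algebra.Definitions.RawMonoid using (sum)
open import Data.Bool.Base using (Bool; true; false; if_then_else_; not; _∧_)
open import Data.Fin.Base using (Fin; toℕ)
open import Data.Fin.Subset using (Subset; inside; outside; ⊥; ⁅_⁆)
import Data.Fin.Properties as Fin
open import Data.Integer.Base as ℤ using (ℤ; +_; -[1+_]; 0ℤ)
import Data.Integer.Properties as ℤ
open import Data.List.Base using (List; []; _∷_; allFin; cartesianProduct; length; map; upTo)
open import Data.Maybe.Base using (Maybe; just; nothing)
open import Data.Nat.Base as ℕ using (ℕ; zero; suc)
import Data.Nat.Properties as ℕ
open import Data.Product.Base using (∃; _×_; _,_)
open import Data.Product.Properties using (≡-dec)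
open import Data.Rational.Base as ℚ using (ℚ; 0ℚ; 1ℚ)
import Data.Rational.Properties as ℚ
open import Data.Vec.Base using (lookup; _[_]≔_)
open import Relation.Binary.Definitions using (DecidableEquality)
open import Relation.Binary.PropositionalEquality using (_≡_)
open import Relation.Nullary.Decidable using (does; yes; no)

private variable
  A B D K S V : Set

------------------------------------------------------------------------

record Instance : Set where
  field
    n m b : ℕ
    w     : Fin n → ℕ
    p     : Fin n → ℤ
    κ     : Fin n → Fin m
    b>0   : 0 ℕ.< b
    w>0   : ∀ i → 0 ℕ.< w i

record Admissible (I : Instance) : Set where
  open Instance I
  field
    classNonempty : ∀ c → ∃ λ i → κ i ≡ c
    w≤b           : ∀ i → w i ℕ.≤ b
    pmax          : ℤ
    pmaxAttained  : ∃ λ r → p r ≡ pmax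
    p≤pmax        : ∀ i → p i ℤ.≤ pmax
    pmax>0        : 0ℤ ℤ.< pmax
    -pmax<p       : ∀ i → ℤ.- pmax ℤ.< p i

------------------------------------------------------------------------

fromℤ : ℤ → ℚ
fromℤ z = z ℚ./ 1

fromℕ : ℕ → ℚ
fromℕ k = fromℤ (+ k)

module LP (I : Instance) where
  open Instance I

  Point : Set
  Point = Fin n → ℚ

  Σᵢ : (Fin n → ℚ) → ℚ
  Σᵢ = sum ℚ.+-0-rawMonoid

  objective : Point → ℚ
  objective x = Σᵢ λ i → fromℤ (p i) ℚ.* x i

  sumInClass sumOffClass : Fin m → Point → ℚ
  sumInClass  c x = Σᵢ λ i → if does (κ i Fin.≟ c) then x i else 0ℚ
  sumOffClass c x = Σᵢ λ i → if does (κ i Fin.≟ c) then 0ℚ else x i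

  record Feasible (x : Point) : Set where
    field
      capacity : Σᵢ (λ i → fromℕ (w i) ℚ.* x i) ℚ.≤ fromℕ b
      colours  : ∀ c → sumInClass c x ℚ.- sumOffClass c x ℚ.≤ 1ℚ
      lower    : ∀ i → 0ℚ ℚ.≤ x i
      upper    : ∀ i → x i ℚ.≤ 1ℚ

  Optimal : Point → Set
  Optimal x = Feasible x × (∀ y → Feasible y → objective y ℚ.≤ objective x)

  ExtremePoint : Point → Set
  ExtremePoint x = Feasible x ×
    (∀ y z t → Feasible y → Feasible z → 0ℚ ℚ.< t → t ℚ.< 1ℚ →
     (∀ i → x i ≡ t ℚ.* y i ℚ.+ (1ℚ ℚ.- t) ℚ.* z i) →
     ∀ i → y i ≡ z i)

------------------------------------------------------------------------
-- A computation carries the number of elementary steps it performs.  Every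
-- arithmetic operation, comparison and table access of the algorithms below
-- goes through op₁, op₂, read, write, new, isFinite or charge.  Loops are
-- charged one additional step per iteration.

record Timed (A : Set) : Set where
  constructor _after_
  field
    value : A
    cost  : ℕ
open Timed public

infixl 1 _>>=_ _>>_

pure : A → Timed A
pure a = a after 0

charge : ℕ → A → Timed A
charge k a = a after k

_>>=_ : Timed A → (A → Timed B) → Timed B
t >>= f = value (f (value t)) after (cost t ℕ.+ cost (f (value t)))

_>>_ : Timed A → Timed B → Timed B
t >> u = t >>= λ _ → u

op₁ : (A → B) → A → Timed B
op₁ f a = charge 1 (f a)

op₂ : (A → B → D) → A → B → Timed D
op₂ f a b = charge 1 (f a b)

for : List A → S → (A → S → Timed S) → Timed S
for []       s body = pure s
for (a ∷ as) s body = do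
  s  ← charge 1 s
  s′ ← body a s
  for as s′ body

Table : Set → Set → Set
Table K V = K → V

read : Table K V → K → Timed V
read T k = charge 1 (T k)

write : DecidableEquality K → Table K V → K → V → Timed (Table K V)
write _≟_ T k v = charge 1 λ k′ → if does (k′ ≟ k) then v else T k′

-- A table whose entries are indexed by the list keys, all initialised to v:
-- one write per entry.
new : List K → V → Timed (Table K V)
new keys v = charge (length keys) λ _ → v

-- The entry +∞ is nothing; distinguishing it from a finite one is a comparison.
isFinite : Maybe V → (V → Timed S) → Timed S → Timed S
isFinite nothing  f e = charge 1 e >>= λ e → e
isFinite (just v) f e = charge 1 v >>= f

-- The best candidate in a list, the earliest one in case of ties; candidates
-- whose score is nothing are disregarded.
best : (V → V → Bool) → List A → (A → Timed (Maybe V)) → Timed (Maybe (A × V))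
best _≻_ as score = for as nothing λ a current → do
  s ← score a
  isFinite s (λ v →
    isFinite current (λ (a′ , v′) → do
      v≻v′ ← op₂ _≻_ v v′
      pure (if v≻v′ then just (a , v) else just (a′ , v′)))
      (pure (just (a , v))))
    (pure current)

-- Table entries are a weight together with information for backtracking.
relax : DecidableEquality K → Table K (Maybe (ℕ × B)) → K → ℕ → B →
        Timed (Table K (Maybe (ℕ × B)))
relax _≟_ T k v tag = do
  old ← read T k
  isFinite old (λ (u , _) → do
    v<u ← op₂ ℕ._<ᵇ_ v u
    if v<u then write _≟_ T k (just (v , tag)) else pure T)
    (write _≟_ T k (just (v , tag)))

_>ℤ_ _<ℤ_ : ℤ → ℤ → Bool
x >ℤ y = not (x ℤ.≤ᵇ y)
x <ℤ y = y >ℤ x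

-- Division with the convention x / 0 = 0, so that algorithms are total.
infixl 7 _÷₀_

_÷₀_ : ℚ → ℚ → ℚ
x ÷₀ y with y ℚ.≟ 0ℚ
... | yes _   = 0ℚ
... | no  y≢0 = (x ℚ.÷ y) ⦃ ℚ.≢-nonZero y≢0 ⦄

-- lo , lo + 1 , … , hi
interval : ℤ → ℤ → List ℤ
interval lo hi with hi ℤ.- lo
... | + k      = map (λ j → lo ℤ.+ + j) (upTo (suc k))
... | -[1+ _ ] = []

------------------------------------------------------------------------

LPSolver : Set
LPSolver = (I : Instance) → Timed (LP.Point I)

record IsLinearTimeLPSolver (lp : LPSolver) : Set where
  field
    optimal : ∀ I → Admissible I → LP.Optimal I (value (lp I))
    extreme : ∀ I → Admissible I → LP.ExtremePoint I (value (lp I))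
    linear  : ∃ λ L → ∀ I → Admissible I → cost (lp I) ℕ.≤ L ℕ.* Instance.n I

module Sets (I : Instance) where
  open Instance I

  items : List (Fin n)
  items = allFin n

  emptySet : Timed (Subset n)
  emptySet = charge n ⊥

  singleton : Fin n → Timed (Subset n)
  singleton i = charge n ⁅ i ⁆

  member : Subset n → Fin n → Timed Bool
  member = op₂ lookup

  insert remove : Fin n → Subset n → Timed (Subset n)
  insert i S = charge 1 (S [ i ]≔ inside)
  remove i S = charge 1 (S [ i ]≔ outside)

  forMembers : Subset n → A → (Fin n → A → Timed A) → Timed A
  forMembers S a body = for items a λ i a → do
    i∈S ← member S i
    if i∈S then body i a else pure a

  profit : Subset n → Timed ℤ
  profit S = forMembers S 0ℤ λ i s → do
    pᵢ ← read p i
    op₂ ℤ._+_ s pᵢ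

  size : Subset n → Timed ℕ
  size S = forMembers S 0 λ _ s → op₁ suc s

  colourCounts : Subset n → Timed (Table (Fin m) ℕ)
  colourCounts S = do
    k₀ ← new (allFin m) 0
    forMembers S k₀ λ i k → do
      c  ← read κ i
      kc ← read k c
      kc ← op₁ suc kc
      write Fin._≟_ k c kc

  mostProfitableItem : Timed (Maybe (Fin n × ℤ))
  mostProfitableItem = best _>ℤ_ items λ i → do
    pᵢ ← read p i
    pure (just pᵢ)

  cheapestMemberOfColour : Fin m → Subset n → Timed (Maybe (Fin n × ℤ))
  cheapestMemberOfColour c S = best _<ℤ_ items λ i → do
    i∈S ← member S i
    κᵢ  ← read κ i
    κ≡c ← op₂ (λ c c′ → does (c Fin.≟ c′)) κᵢ c
    pᵢ  ← read p i
    pure (if i∈S ∧ κ≡c then just pᵢ else nothing)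

  repair : Subset n → Timed (Subset n)
  repair S = do
    k   ← colourCounts S
    dom ← best (λ j j′ → j′ ℕ.<ᵇ j) (allFin m) λ c → do
      kc ← read k c
      pure (just kc)
    isFinite dom (λ (c , d) → do
      s        ← size S
      2d       ← op₂ ℕ._*_ 2 d
      s+1      ← op₁ suc s
      feasible ← op₂ ℕ._≤ᵇ_ 2d s+1
      if feasible then pure S else (do
        i ← cheapestMemberOfColour c S
        isFinite i (λ (i , _) → remove i S) (pure S)))
      (pure S)

module LPRound (lp : LPSolver) (I : Instance) where
  open Instance I
  open Sets I

  roundDown : LP.Point I → Timed (Subset n)
  roundDown x = do
    ∅ ← emptySet
    for items ∅ λ i S → do
      xᵢ  ← read x i
      one ← op₂ (λ x y → does (x ℚ.≟ y)) xᵢ 1ℚ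
      if one then insert i S else pure S

  lpRound : Timed (Subset n)
  lpRound = do
    x  ← lp I
    S₀ ← roundDown x
    S₀ ← repair S₀
    r  ← mostProfitableItem
    isFinite r (λ (r , pᵣ) → do
      P   ← profit S₀
      S₀≥ ← op₂ ℤ._≤ᵇ_ pᵣ P
      if S₀≥ then pure S₀ else singleton r)
      (pure S₀)

------------------------------------------------------------------------

-- Everything that follows the scaling and the choice of the profit range
-- 𝒵 = {z-min , … , z-max}.
module Programs (I : Instance) (p̂ : Table (Fin (Instance.n I)) ℤ) (z-min z-max : ℤ) where
  open Instance I
  open Sets I

  𝒵 : List ℤ
  𝒵 = interval z-min z-max

  transitionAllowed : ℤ → ℕ → Timed Bool
  transitionAllowed z v = do
    lo ← op₂ ℤ._≤ᵇ_ z-min z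
    hi ← op₂ ℤ._≤ᵇ_ z z-max
    wt ← op₂ ℕ._≤ᵇ_ v b
    pure (lo ∧ hi ∧ wt)

  InnerKey : Set
  InnerKey = ℕ × ℤ

  _≟ᵢ_ : DecidableEquality InnerKey
  _≟ᵢ_ = ≡-dec ℕ._≟_ ℤ._≟_

  -- The tag records whether the last processed item is packed.
  InnerTable : Set
  InnerTable = Table InnerKey (Maybe (ℕ × Bool))

  -- stages lists the processed items with the table obtained after each, the
  -- last one first; levels is the set 𝒮 of the finite entries of final.
  record Inner : Set where
    field
      final  : InnerTable
      stages : List (Fin n × InnerTable)
      levels : List InnerKey
  open Inner public

  colourClass : Fin m → Timed (List (Fin n) × ℕ)
  colourClass c = for items ([] , 0) λ i (is , k) → do
    κᵢ  ← read κ i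
    κ≡c ← op₂ (λ c c′ → does (c Fin.≟ c′)) κᵢ c
    if κ≡c
      then (do is ← op₂ _∷_ i is
               k  ← op₁ suc k
               pure (is , k))
      else pure (is , k)

  processItem : List InnerKey → Fin n → InnerTable → Timed InnerTable
  processItem keys i h = do
    h₀ ← new keys nothing
    wᵢ ← read w i
    p̂ᵢ ← read p̂ i
    for keys h₀ λ (k , ζ) h′ → do
      e ← read h (k , ζ)
      isFinite e (λ (v , _) → do
        h′ ← relax _≟ᵢ_ h′ (k , ζ) v false
        k⁺ ← op₁ suc k
        ζ⁺ ← op₂ ℤ._+_ ζ p̂ᵢ
        v⁺ ← op₂ ℕ._+_ v wᵢ
        ok ← transitionAllowed ζ⁺ v⁺
        if ok then relax _≟ᵢ_ h′ (k⁺ , ζ⁺) v⁺ true else pure h′)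
        (pure h′)

  innerProgram : Fin m → Timed Inner
  innerProgram c = do
    (Ic , size) ← colourClass c
    let keys = cartesianProduct (upTo (suc size)) 𝒵
    h ← new keys nothing
    h ← write _≟ᵢ_ h (0 , 0ℤ) (just (0 , false))
    (h , st) ← for Ic (h , []) λ i (h , st) → do
      h  ← processItem keys i h
      st ← op₂ _∷_ (i , h) st
      pure (h , st)
    𝒮 ← for keys [] λ kζ 𝒮 → do
      e ← read h kζ
      isFinite e (λ _ → op₂ _∷_ kζ 𝒮) (pure 𝒮)
    pure (record { final = h ; stages = st ; levels = 𝒮 })

  -- The colours with their inner programs, the last colour first.
  innerPrograms : Timed (List (Fin m × Inner))
  innerPrograms = for (allFin m) [] λ c Hs → do
    H ← innerProgram c
    op₂ _∷_ (c , H) Hs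

  State : Set
  State = ℕ × ℕ × ℤ

  OuterKey : Set
  OuterKey = ℕ × State

  _≟ₒ_ : DecidableEquality OuterKey
  _≟ₒ_ = ≡-dec ℕ._≟_ (≡-dec ℕ._≟_ (≡-dec ℕ._≟_ ℤ._≟_))

  -- The tag is the preceding state (t , d , z) and the inner level (k , ζ).
  OuterTable : Set
  OuterTable = Table OuterKey (Maybe (ℕ × State × InnerKey))

  layer : List State
  layer = cartesianProduct (upTo (suc n)) (cartesianProduct (upTo (suc n)) 𝒵)

  -- Colour c ∈ Fin m is the (toℕ c + 1)-st one: it leads from the entries
  -- g(toℕ c , …) to the entries g(toℕ c + 1 , …).
  outerStep : Fin m → Inner → OuterTable → Timed OuterTable
  outerStep c H g = for layer g λ (t , d , z) g → do
    e ← read g (toℕ c , t , d , z)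
    isFinite e (λ (v , _) →
      for (levels H) g λ (k , ζ) g → do
        e′ ← read (final H) (k , ζ)
        isFinite e′ (λ (u , _) → do
          t⁺ ← op₂ ℕ._+_ t k
          d⁺ ← op₂ ℕ._⊔_ d k
          z⁺ ← op₂ ℤ._+_ z ζ
          v⁺ ← op₂ ℕ._+_ v u
          ok ← transitionAllowed z⁺ v⁺
          if ok
            then relax _≟ₒ_ g (suc (toℕ c) , t⁺ , d⁺ , z⁺) v⁺ ((t , d , z) , (k , ζ))
            else pure g)
          (pure g))
      (pure g)

  -- The argument is in reverse order of the colours, as produced by
  -- innerPrograms.
  outerProgram : List (Fin m × Inner) → Timed OuterTable
  outerProgram Hs = do
    g  ← new (cartesianProduct (upTo (suc m)) layer) nothing
    g  ← write _≟ₒ_ g (0 , 0 , 0 , 0ℤ) (just (0 , (0 , 0 , 0ℤ) , (0 , 0ℤ)))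
    Hs ← for Hs [] (op₂ _∷_)
    for Hs g λ (c , H) g → outerStep c H g

  bestTerminal : OuterTable → Timed (Maybe (State × ℤ))
  bestTerminal g = best _>ℤ_ layer λ (t , d , z) → do
    e ← read g (m , t , d , z)
    isFinite e (λ (v , _) → do
      v≤b ← op₂ ℕ._≤ᵇ_ v b
      2d  ← op₂ ℕ._*_ 2 d
      t+1 ← op₁ suc t
      cf  ← op₂ ℕ._≤ᵇ_ 2d t+1
      pure (if v≤b ∧ cf then just z else nothing))
      (pure nothing)

  backtrackInner : Inner → InnerKey → Subset n → Timed (Subset n)
  backtrackInner H kζ S = do
    (S , _) ← for (stages H) (S , kζ) λ (i , h) (S , k , ζ) → do
      e ← read h (k , ζ)
      isFinite e (λ (_ , packed) →
        if packed
          then (do S  ← insert i S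
                   k  ← op₁ ℕ.pred k
                   p̂ᵢ ← read p̂ i
                   ζ  ← op₂ ℤ._-_ ζ p̂ᵢ
                   pure (S , k , ζ))
          else pure (S , k , ζ))
        (pure (S , k , ζ))
    pure S

  backtrack : List (Fin m × Inner) → OuterTable → State → Timed (Subset n)
  backtrack Hs g s = do
    ∅ ← emptySet
    (S , _) ← for Hs (∅ , s) λ (c , H) (S , s) → do
      e ← read g (suc (toℕ c) , s)
      isFinite e (λ (_ , s⁻ , kζ) → do
        S ← backtrackInner H kζ S
        pure (S , s⁻))
        (pure (S , s))
    pure S

  dynamicProgram : Timed (Subset n)
  dynamicProgram = do
    Hs ← innerPrograms
    g  ← outerProgram Hs
    s  ← bestTerminal g
    isFinite s (λ (s , _) → backtrack Hs g s) emptySet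

module F2 (lp : LPSolver) (I : Instance) (ε : ℚ) where
  open Instance I
  open Sets I
  open LPRound lp I

  scaledProfits : ℚ → Timed (Table (Fin n) ℤ)
  scaledProfits step = do
    p̂₀ ← new items 0ℤ
    for items p̂₀ λ i p̂ → do
      pᵢ ← read p i
      q  ← op₂ _÷₀_ (fromℤ pᵢ) step
      p̂ᵢ ← op₁ ℚ.floor q
      write Fin._≟_ p̂ i p̂ᵢ

  allNonnegative : Timed Bool
  allNonnegative = for items true λ i acc → do
    pᵢ ← read p i
    ≥0 ← op₂ ℤ._≤ᵇ_ 0ℤ pᵢ
    op₂ _∧_ acc ≥0

  maxProfit : Timed ℤ
  maxProfit = do
    r ← mostProfitableItem
    isFinite r (λ (_ , pᵣ) → pure pᵣ) (pure 0ℤ)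

  profitRange : ℚ → ℤ → Timed (ℤ × ℤ)
  profitRange step UB = do
    nonneg ← allNonnegative
    if nonneg
      then (do q  ← op₂ _÷₀_ (fromℤ UB) step
               hi ← op₁ ℚ.ceiling q
               pure (0ℤ , hi))
      else (do pmax   ← maxProfit
               npmax  ← op₂ ℤ._*_ (+ n) pmax
               -npmax ← op₁ ℤ.-_ npmax
               q      ← op₂ _÷₀_ (fromℤ -npmax) step
               lo     ← op₁ ℚ.floor q
               top    ← op₂ ℤ._+_ UB npmax
               q′     ← op₂ _÷₀_ (fromℤ top) step
               hi     ← op₁ ℚ.ceiling q′
               pure (lo , hi))

  algorithmF2 : Timed (Subset n)
  algorithmF2 = do
    S       ← lpRound
    LB      ← profit S
    UB      ← op₂ ℤ._*_ (+ 3) LB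
    εLB     ← op₂ ℚ._*_ ε (fromℤ LB)
    step    ← op₂ _÷₀_ εLB (fromℕ n)
    p̂       ← scaledProfits step
    (z-min , z-max) ← profitRange step UB
    Programs.dynamicProgram I p̂ z-min z-max

open F2 public using (algorithmF2)

runningTime : LPSolver → Instance → ℚ → ℕ
runningTime lp I ε = cost (algorithmF2 lp I ε)

{-# OPTIONS --safe #-}

-- Write Z for the number of profit levels.  The outer program has n² Z states per
-- layer, and a colour c offers at most (|I_c| + 1) Z inner levels; since Σ_c |I_c| = n
-- and m ≤ n, all the outer transitions together number O(n² Z · n Z) = O(n³ Z²), and
-- this dominates every other step.  LB is at least p_max > 0, because LP-Round also
-- considers the singleton of a most profitable item.  A profit range of length x is
-- therefore cut into x n / (ε LB) levels: with x = 3 LB this gives Z = O(n / ε), and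
-- with x = 3 LB + 2 n p_max it gives Z = O(n² / ε).

module Submission where

open import Defs
open import Data.Bool.Base as Bool using (Bool; true; false; if_then_else_; _∧_)
open import Data.Fin.Base using (Fin; toℕ)
import Data.Fin.Properties as Fin
open import Data.Fin.Subset using (Subset; ⁅_⁆)
open import Data.Integer.Base as ℤ using (ℤ; 0ℤ)
import Data.Integer.DivMod as ℤ
import Data.Integer.Properties as ℤ
import Data.Integer.Tactic.RingSolver as ℤSolver
open import Data.List.Base using (List; []; _∷_; allFin; cartesianProduct; length; map; upTo)
open import Data.List.Properties using (length-++; length-map; length-upTo; length-tabulate)
open import Data.List.Membership.Propositional using (_∈_)
open import Data.List.Membership.Propositional.Properties using (∈-allFin)
open import Data.List.Relation.Unary.All as All using (All; []; _∷_)
open import Data.List.Relation.Unary.Any using (here; there)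
open import Data.List.Relation.Unary.AllPairs using ([]; _∷_)
open import Data.List.Relation.Unary.Unique.Propositional using (Unique)
open import Data.List.Relation.Unary.Unique.Propositional.Properties using (allFin⁺)
open import Data.Maybe.Base using (Maybe; just; nothing)
open import Data.Nat.Base as ℕ using (ℕ; suc; _+_; _*_; _≤_; z≤n; s≤s)
open import Data.Nat.ListAction using (sum)
import Data.Nat.Properties as ℕ
open import Data.Nat.Tactic.RingSolver using (solve-∀)
open import Data.Product.Base using (∃; _×_; _,_; proj₁; proj₂)
open import Data.Rational.Base as ℚ using (ℚ; 0ℚ; 1ℚ)
import Data.Rational.Properties as ℚ
open import Data.Rational.Solver using (module +-*-Solver)
import Data.Rational.Unnormalised.Base as ℚᵘ
import Data.Rational.Unnormalised.Properties as ℚᵘ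
open import Data.Unit.Base using (tt)
open import Data.Vec.Base using (lookup)
open import Data.Vec.Properties using (lookup-replicate)
open import Relation.Binary.Definitions using (DecidableEquality)
open import Relation.Binary.PropositionalEquality
open import Relation.Nullary.Decidable using (does; yes; no)
open import Relation.Nullary.Negation using (contradiction)

-- Cost bounds are proved for an arbitrary loop state, so nothing has to be known about the contents
-- of the tables: every test is charged with a bound covering both outcomes. Computed values matter
-- in two ways only. The lengths of the lists built by one loop (class items, levels, stages) decide
-- how often later loops run; they are controlled by a potential on the loop state that grows by a
-- bounded amount per iteration. And the computed profits determine the profit range. With `Z` one
-- more than the number of levels, the estimates for the range have the product form `Z ε ≤ 7 n` or
-- `Z ε ≤ 9 n²`. Multiplying the running time by `ε²` pairs one `ε` with each of the two factors
-- `Z`, so that the division by `ε²` appears only at the very end. Lower-order terms, including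
-- those caused by rounding, are absorbed because all size parameters are kept at least 1.

private variable
  A B K S V : Set

-- Cost of loops and conditionals, growth of loop states

if-cost : ∀ c {t u : Timed A} {k} → cost t ≤ k → cost u ≤ k → cost (if c then t else u) ≤ k
if-cost true  t≤k u≤k = t≤k
if-cost false t≤k u≤k = u≤k

isFinite-cost : ∀ x {f : V → Timed S} {e k} → (∀ v → cost (f v) ≤ k) → cost e ≤ k →
                cost (isFinite x f e) ≤ suc k
isFinite-cost nothing  f≤k e≤k = s≤s e≤k
isFinite-cost (just v) f≤k e≤k = s≤s (f≤k v)

for-cost : ∀ (as : List A) (s : S) {body} (f : A → ℕ) → (∀ a s → cost (body a s) ≤ f a) →
           cost (for as s body) ≤ sum (map (λ a → suc (f a)) as)
for-cost []       s f body≤f = z≤n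
for-cost (a ∷ as) s f body≤f = s≤s (ℕ.+-mono-≤ (body≤f a s) (for-cost as _ f body≤f))

sum-const : ∀ k (as : List A) → sum (map (λ _ → k) as) ≡ length as * k
sum-const k []       = refl
sum-const k (a ∷ as) = cong (k +_) (sum-const k as)

sum-affine : ∀ j k (f : A → ℕ) as →
             sum (map (λ a → j + k * f a) as) ≡ length as * j + k * sum (map f as)
sum-affine j k f []       = sym (ℕ.*-zeroʳ k)
sum-affine j k f (a ∷ as) rewrite sum-affine j k f as =
  shuffle j k (f a) (length as) (sum (map f as))
  where
  shuffle : ∀ j k x l s → j + k * x + (l * j + k * s) ≡ j + l * j + k * (x + s)
  shuffle = solve-∀

for-const-cost : ∀ (as : List A) {l} → length as ≤ l → (s : S) → ∀ {body k} →
                 (∀ a s → cost (body a s) ≤ k) → cost (for as s body) ≤ l * suc k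
for-const-cost as {l} as≤l s {body} {k} body≤k = begin
  cost (for as s body)           ≤⟨ for-cost as s (λ _ → k) body≤k ⟩
  sum (map (λ _ → suc k) as)     ≡⟨ sum-const (suc k) as ⟩
  length as * suc k              ≤⟨ ℕ.*-monoˡ-≤ (suc k) as≤l ⟩
  l * suc k                      ∎
  where open ℕ.≤-Reasoning

-- A telescoping argument. With a length or a counter as `Φ` it limits the lists that a loop builds,
-- and hence the number of iterations of the loops running over them.
for-potential : (Φ : S → ℕ) (f : A → ℕ) → ∀ as s {body} →
                (∀ a s → Φ (value (body a s)) ≤ f a + Φ s) →
                Φ (value (for as s body)) ≤ sum (map f as) + Φ s
for-potential Φ f []       s step = ℕ.≤-refl
for-potential Φ f (a ∷ as) s {body} step = begin
  Φ (value (for as s′ body))        ≤⟨ for-potential Φ f as s′ step ⟩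
  sum (map f as) + Φ s′             ≤⟨ ℕ.+-monoʳ-≤ (sum (map f as)) (step a s) ⟩
  sum (map f as) + (f a + Φ s)      ≡⟨ ℕ.+-assoc (sum (map f as)) (f a) (Φ s) ⟨
  sum (map f as) + f a + Φ s        ≡⟨ cong (_+ Φ s) (ℕ.+-comm (sum (map f as)) (f a)) ⟩
  f a + sum (map f as) + Φ s        ∎
  where
  open ℕ.≤-Reasoning
  s′ = value (body a s)

-- The growth is written as a conditional so that it agrees definitionally with `indicator` when `c`
-- is a test of colours.
if-potential : ∀ (Φ : S → ℕ) c {t u : Timed S} {k} → Φ (value t) ≤ suc k → Φ (value u) ≤ k →
               Φ (value (if c then t else u)) ≤ (if c then 1 else 0) + k
if-potential Φ true  t≤ u≤ = t≤
if-potential Φ false t≤ u≤ = u≤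

sum-reversed : ∀ (f : A → ℕ) as → sum (map f (value (for as [] (op₂ _∷_)))) ≤ sum (map f as)
sum-reversed f as = subst (sum (map f (value (for as [] (op₂ _∷_)))) ≤_) (ℕ.+-identityʳ _)
  (for-potential (λ as → sum (map f as)) f as [] {op₂ _∷_} λ _ _ → ℕ.≤-refl)

isFinite-potential : ∀ (Φ : S → ℕ) (x : Maybe V) {f : V → Timed S} {e k} →
                     (∀ v → Φ (value (f v)) ≤ k) → Φ (value e) ≤ k →
                     Φ (value (isFinite x f e)) ≤ k
isFinite-potential Φ nothing  f≤k e≤k = e≤k
isFinite-potential Φ (just v) f≤k e≤k = f≤k v

-- The 4 counts the loop step, the finiteness tests of the score and of the current candidate, and
-- the comparison of the two.
best-cost : ∀ (_≻_ : V → V → Bool) (as : List A) {l} → length as ≤ l → ∀ score {k} →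
            (∀ a → cost (score a) ≤ k) → cost (best _≻_ as score) ≤ l * (4 + k)
best-cost _≻_ as as≤l score {k} score≤k = for-const-cost as as≤l nothing λ a current →
  ℕ.≤-trans
    (ℕ.+-mono-≤ (score≤k a)
      (isFinite-cost (value (score a)) {k = 2}
        (λ v → isFinite-cost current (λ _ → s≤s z≤n) z≤n)
        z≤n))
    (ℕ.≤-reflexive (ℕ.+-comm k 3))

relax-cost : (_≟_ : DecidableEquality K) (T : Table K (Maybe (ℕ × B))) → ∀ k v tag →
             cost (relax _≟_ T k v tag) ≤ 4
relax-cost _≟_ T k v tag =
  s≤s (isFinite-cost (T k) (λ (u , _) → s≤s (if-cost (v ℕ.<ᵇ u) ℕ.≤-refl z≤n)) (s≤s z≤n))

-- Exchange of sums and counting of items by colour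

sum-mono : ∀ {f g : A → ℕ} → (∀ a → f a ≤ g a) → ∀ as → sum (map f as) ≤ sum (map g as)
sum-mono f≤g []       = z≤n
sum-mono f≤g (a ∷ as) = ℕ.+-mono-≤ (f≤g a) (sum-mono f≤g as)

sum-distrib-+ : ∀ (f g : A → ℕ) as →
                sum (map (λ a → f a + g a) as) ≡ sum (map f as) + sum (map g as)
sum-distrib-+ f g []       = refl
sum-distrib-+ f g (a ∷ as) rewrite sum-distrib-+ f g as =
  interchange (f a) (g a) (sum (map f as)) (sum (map g as))
  where
  interchange : ∀ x y s t → x + y + (s + t) ≡ x + s + (y + t)
  interchange = solve-∀

sum-swap : ∀ (f : A → B → ℕ) as bs →
           sum (map (λ a → sum (map (f a) bs)) as) ≡ sum (map (λ b → sum (map (λ a → f a b) as)) bs)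
sum-swap f []       bs = sym (trans (sum-const 0 bs) (ℕ.*-zeroʳ (length bs)))
sum-swap f (a ∷ as) bs = trans
  (cong (sum (map (f a) bs) +_) (sum-swap f as bs))
  (sym (sum-distrib-+ (f a) (λ b → sum (map (λ a → f a b) as)) bs))

indicator : ∀ {m} → Fin m → Fin m → ℕ
indicator c₀ c = if does (c₀ Fin.≟ c) then 1 else 0

sum-indicator-∉ : ∀ {m} {c₀ : Fin m} {cs} → All (c₀ ≢_) cs → sum (map (indicator c₀) cs) ≡ 0
sum-indicator-∉ [] = refl
sum-indicator-∉ {c₀ = c₀} (_∷_ {x = c} c₀≢c c₀∉cs) with c₀ Fin.≟ c
... | yes c₀≡c = contradiction c₀≡c c₀≢c
... | no  _    = sum-indicator-∉ c₀∉cs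

-- Once `c₀` has been met, the rest of a duplicate-free list contributes nothing.
sum-indicator≤1 : ∀ {m} (c₀ : Fin m) {cs} → Unique cs → sum (map (indicator c₀) cs) ≤ 1
sum-indicator≤1 c₀ [] = z≤n
sum-indicator≤1 c₀ (_∷_ {x = c} c∉cs unique) with c₀ Fin.≟ c
... | yes refl = ℕ.≤-reflexive (cong suc (sum-indicator-∉ c∉cs))
... | no  _    = sum-indicator≤1 c₀ unique

length-allFin≤ : ∀ n → length (allFin n) ≤ n
length-allFin≤ n = ℕ.≤-reflexive (length-tabulate {n = n} (λ i → i))

length-cartesianProduct : ∀ (as : List A) (bs : List B) →
                          length (cartesianProduct as bs) ≡ length as * length bs
length-cartesianProduct []       bs = refl
length-cartesianProduct (a ∷ as) bs = trans
  (length-++ (map (a ,_) bs))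
  (cong₂ _+_ (length-map (a ,_) bs) (length-cartesianProduct as bs))

-- Cost of the operations on item sets and of LP-Round

module _ (I : Instance) where
  open Instance I
  open Sets I

  forMembers-cost : ∀ X (a : A) {body k} → (∀ i a → cost (body i a) ≤ k) →
                    cost (forMembers X a body) ≤ n * (2 + k)
  forMembers-cost X a {k = k} body≤k =
    for-const-cost items (length-allFin≤ n) a λ i s → s≤s (if-cost (value (member X i)) (body≤k i s) z≤n)

  profit-cost : ∀ X → cost (profit X) ≤ n * 4
  profit-cost X = forMembers-cost X 0ℤ λ i s → ℕ.≤-refl

  size-cost : ∀ X → cost (size X) ≤ n * 3
  size-cost X = forMembers-cost X 0 λ i s → ℕ.≤-refl

  colourCounts-cost : ∀ X → cost (colourCounts X) ≤ m + n * 6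
  colourCounts-cost X =
    ℕ.+-mono-≤ (length-allFin≤ m) (forMembers-cost X _ λ i k → ℕ.≤-refl)

  mostProfitableItem-cost : cost mostProfitableItem ≤ n * 5
  mostProfitableItem-cost =
    best-cost _>ℤ_ items (length-allFin≤ n) (λ i → read p i >>= λ pᵢ → pure (just pᵢ)) λ i → ℕ.≤-refl

  cheapestMemberOfColour-cost : ∀ c X → cost (cheapestMemberOfColour c X) ≤ n * 8
  cheapestMemberOfColour-cost c X =
    best-cost _<ℤ_ items (length-allFin≤ n)
      (λ i → member X i >>= λ i∈X → read κ i >>= λ κᵢ →
        op₂ (λ c c′ → does (c Fin.≟ c′)) κᵢ c >>= λ κ≡c → read p i >>= λ pᵢ →
        pure (if i∈X ∧ κ≡c then just pᵢ else nothing))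
      λ i → ℕ.≤-refl

  repair-cost : ∀ X → cost (repair X) ≤ m + n * 6 + (m * 5 + suc (n * 3 + (3 + (n * 8 + 2))))
  repair-cost X = ℕ.+-mono-≤ (colourCounts-cost X) (ℕ.+-mono-≤
    (best-cost _≻_ (allFin m) (length-allFin≤ m) count λ i → ℕ.≤-refl)
    (isFinite-cost dom
      (λ (c , d) → ℕ.+-mono-≤ (size-cost X) (ℕ.+-monoʳ-≤ 3 (if-cost (2 * d ℕ.≤ᵇ suc (value (size X))) z≤n
        (ℕ.+-mono-≤ (cheapestMemberOfColour-cost c X)
          (isFinite-cost (value (cheapestMemberOfColour c X)) (λ _ → ℕ.≤-refl) z≤n)))))
      z≤n))
    where
    count : Fin m → Timed (Maybe ℕ)
    count c = read (value (colourCounts X)) c >>= λ k → pure (just k)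
    _≻_ : ℕ → ℕ → Bool
    j ≻ j′ = j′ ℕ.<ᵇ j
    dom = value (best _≻_ (allFin m) count)

  module _ (lp : LPSolver) where
    open LPRound lp I

    roundDown-cost : ∀ x → cost (roundDown x) ≤ n + n * 4
    roundDown-cost x = ℕ.+-monoʳ-≤ n
      (for-const-cost items (length-allFin≤ n) _ λ i X → ℕ.+-monoʳ-≤ 2 (if-cost (does (x i ℚ.≟ 1ℚ)) ℕ.≤-refl z≤n))

    lpRound-cost : cost lpRound ≤ cost (lp I) + (n + n * 4 + (m + n * 6 +
      (m * 5 + suc (n * 3 + (3 + (n * 8 + 2)))) + (n * 5 + suc (n * 4 + suc n))))
    lpRound-cost = ℕ.+-monoʳ-≤ (cost (lp I)) (ℕ.+-mono-≤ (roundDown-cost (value (lp I)))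
      (ℕ.+-mono-≤ (repair-cost _) (ℕ.+-mono-≤ mostProfitableItem-cost
        (isFinite-cost (value mostProfitableItem)
          (λ (r , pᵣ) → ℕ.+-mono-≤ (profit-cost S₀)
            (s≤s (if-cost (pᵣ ℤ.≤ᵇ value (profit S₀)) z≤n ℕ.≤-refl)))
          z≤n))))
      where S₀ = value (repair (value (roundDown (value (lp I)))))

  -- Inner and outer programs: cost of the steps and lengths of the lists

  module _ (p̂ : Table (Fin n) ℤ) (z-min z-max : ℤ) where
    open Programs I p̂ z-min z-max

    classItems : Fin m → List (Fin n)
    classItems c = proj₁ (value (colourClass c))

    classSize : Fin m → ℕ
    classSize c = proj₂ (value (colourClass c))

    colourClass-cost : ∀ c → cost (colourClass c) ≤ n * 5
    colourClass-cost c =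
      for-const-cost items (length-allFin≤ n) _ λ i _ → s≤s (s≤s (if-cost (does (κ i Fin.≟ c)) ℕ.≤-refl z≤n))

    -- The size of the color class of `c`, encoded as a sum over the items so that it can be
    -- exchanged with a sum over the colors.
    multiplicity : Fin m → ℕ
    multiplicity c = sum (map (λ i → indicator (κ i) c) items)

    classSize≤multiplicity : ∀ c → classSize c ≤ multiplicity c
    classSize≤multiplicity c = subst (classSize c ≤_) (ℕ.+-identityʳ (multiplicity c))
      (for-potential proj₂ (λ i → indicator (κ i) c) items ([] , 0)
        λ i s → if-potential proj₂ (does (κ i Fin.≟ c)) ℕ.≤-refl ℕ.≤-refl)

    length-classItems : ∀ c → length (classItems c) ≤ multiplicity c
    length-classItems c = subst (length (classItems c) ≤_) (ℕ.+-identityʳ (multiplicity c))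
      (for-potential (λ s → length (proj₁ s)) (λ i → indicator (κ i) c) items ([] , 0)
        λ i s → if-potential (λ s → length (proj₁ s)) (does (κ i Fin.≟ c)) ℕ.≤-refl ℕ.≤-refl)

    -- With the sum over the items outermost, each item contributes at most 1, because it has a
    -- single color.
    sum-multiplicity : sum (map multiplicity (allFin m)) ≤ n
    sum-multiplicity = begin
      sum (map multiplicity (allFin m))                               ≡⟨ sum-swap (λ c i → indicator (κ i) c) (allFin m) items ⟩
      sum (map (λ i → sum (map (indicator (κ i)) (allFin m))) items)  ≤⟨ sum-mono (λ i → sum-indicator≤1 (κ i) (allFin⁺ m)) items ⟩
      sum (map (λ _ → 1) items)                                       ≡⟨ sum-const 1 items ⟩
      length items * 1                                                ≡⟨ ℕ.*-identityʳ (length items) ⟩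
      length items                                                    ≤⟨ length-allFin≤ n ⟩
      n                                                               ∎
      where open ℕ.≤-Reasoning

    processItem-cost : ∀ keys {l} → length keys ≤ l → ∀ i h →
                       cost (processItem keys i h) ≤ l + (2 + l * 17)
    processItem-cost keys keys≤l i h = ℕ.+-mono-≤ keys≤l (s≤s (s≤s
      (for-const-cost keys keys≤l _ λ (k , ζ) h′ → s≤s
        -- 14 = 4 + 3 + 3 + 4: relaxation without the item, arithmetic, the three tests of the
        -- transition, relaxation with the item.
        (isFinite-cost (h (k , ζ)) {k = 14}
          (λ (v , _) → ℕ.+-mono-≤ (relax-cost _≟ᵢ_ h′ (k , ζ) v false)
            (ℕ.+-monoʳ-≤ 6 (if-cost (value (transitionAllowed (ζ ℤ.+ p̂ i) (v + w i)))
              (relax-cost _≟ᵢ_ (value (relax _≟ᵢ_ h′ (k , ζ) v false)) (suc k , ζ ℤ.+ p̂ i) (v + w i) true)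
              z≤n)))
          z≤n))))

    levelKeys : Fin m → List InnerKey
    levelKeys c = cartesianProduct (upTo (suc (classSize c))) 𝒵

    length-levelKeys : ∀ c → length (levelKeys c) ≡ suc (classSize c) * length 𝒵
    length-levelKeys c = trans
      (length-cartesianProduct (upTo (suc (classSize c))) 𝒵)
      (cong (_* length 𝒵) (length-upTo (suc (classSize c))))

    -- The body of the item loop in `innerProgram` receives a name so that the table and the stages
    -- resulting from that loop can be referred to.
    packItem : List InnerKey → Fin n → InnerTable × List (Fin n × InnerTable) →
               Timed (InnerTable × List (Fin n × InnerTable))
    packItem keys i (h , st) =
      processItem keys i h >>= λ h → op₂ _∷_ (i , h) st >>= λ st → pure (h , st)

    initialTable : InnerTable
    initialTable = value (write _≟ᵢ_ (λ _ → nothing) (0 , 0ℤ) (just (0 , false)))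

    finalTable : Fin m → InnerTable
    finalTable c = proj₁ (value (for (classItems c) (initialTable , []) (packItem (levelKeys c))))

    -- The bound follows the program term by term; the trailing `+ 0` is the cost of a `pure`, here
    -- and in the bounds for backtracking.
    innerProgram-cost : ∀ {N T} c → n ≤ N → length (classItems c) ≤ N → length (levelKeys c) ≤ T →
      cost (innerProgram c) ≤ N * 5 + (T + suc (N * suc (T + (2 + T * 17) + 1) + (T * 4 + 0)))
    innerProgram-cost c n≤N items≤N keys≤T = ℕ.+-mono-≤
      (ℕ.≤-trans (colourClass-cost c) (ℕ.*-monoˡ-≤ 5 n≤N))
      (ℕ.+-mono-≤ keys≤T (s≤s (ℕ.+-mono-≤
        (for-const-cost (classItems c) items≤N _ λ i (h , st) →
          ℕ.+-monoˡ-≤ 1 (processItem-cost (levelKeys c) keys≤T i h))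
        (ℕ.+-monoˡ-≤ 0 (for-const-cost (levelKeys c) keys≤T _ λ kζ _ →
          s≤s (isFinite-cost (finalTable c kζ) {k = 1} (λ _ → ℕ.≤-refl) z≤n))))))

    -- Each key is collected at most once, so it is irrelevant which entries turn out finite.
    length-levels : ∀ c → length (levels (value (innerProgram c))) ≤ suc (classSize c) * length 𝒵
    length-levels c = begin
      length (levels (value (innerProgram c)))  ≤⟨ for-potential length (λ _ → 1) (levelKeys c) []
                                                     (λ kζ 𝒮 → isFinite-potential length (finalTable c kζ)
                                                       (λ _ → ℕ.≤-refl) (ℕ.n≤1+n _)) ⟩
      sum (map (λ _ → 1) (levelKeys c)) + 0     ≡⟨ ℕ.+-identityʳ _ ⟩
      sum (map (λ _ → 1) (levelKeys c))         ≡⟨ sum-const 1 (levelKeys c) ⟩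
      length (levelKeys c) * 1                  ≡⟨ ℕ.*-identityʳ _ ⟩
      length (levelKeys c)                      ≡⟨ length-levelKeys c ⟩
      suc (classSize c) * length 𝒵              ∎
      where open ℕ.≤-Reasoning

    length-stages : ∀ c → length (stages (value (innerProgram c))) ≤ multiplicity c
    length-stages c = begin
      length (stages (value (innerProgram c)))  ≤⟨ for-potential (λ s → length (proj₂ s)) (λ _ → 1)
                                                     (classItems c) (initialTable , []) {packItem (levelKeys c)}
                                                     (λ _ _ → ℕ.≤-refl) ⟩
      sum (map (λ _ → 1) (classItems c)) + 0    ≡⟨ ℕ.+-identityʳ _ ⟩
      sum (map (λ _ → 1) (classItems c))        ≡⟨ sum-const 1 (classItems c) ⟩
      length (classItems c) * 1                 ≡⟨ ℕ.*-identityʳ _ ⟩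
      length (classItems c)                     ≤⟨ length-classItems c ⟩
      multiplicity c                            ∎
      where open ℕ.≤-Reasoning

    -- Here the sum itself is the potential. Each color keeps its own bound `g c`, which allows
    -- amortization over the colors; a uniform bound would lose a factor of order `n`.
    sum-innerPrograms : ∀ (f : Inner → ℕ) {g} → (∀ c → f (value (innerProgram c)) ≤ g c) →
      sum (map (λ (c , H) → f H) (value innerPrograms)) ≤ sum (map g (allFin m))
    sum-innerPrograms f {g} f≤g = subst (_ ≤_) (ℕ.+-identityʳ (sum (map g (allFin m))))
      (for-potential (λ Hs → sum (map (λ (c , H) → f H) Hs)) g (allFin m) []
        λ c Hs → ℕ.+-monoˡ-≤ (sum (map (λ (c , H) → f H) Hs)) (f≤g c))

    outerStep-cost : ∀ {Y} → length layer ≤ Y → ∀ c H g →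
                     cost (outerStep c H g) ≤ Y * (3 + length (levels H) * 14)
    outerStep-cost layer≤Y c H g = for-const-cost layer layer≤Y g λ (t , d , z) g → s≤s
      (isFinite-cost (g (toℕ c , t , d , z))
        (λ (v , _) → for-const-cost (levels H) ℕ.≤-refl g λ (k , ζ) g → s≤s
          -- 11 = 4 + 3 + 4: computation of the new state and weight, the tests of the transition,
          -- the relaxation.
          (isFinite-cost (final H (k , ζ)) {k = 11}
            (λ (u , _) → ℕ.+-monoʳ-≤ 7 (if-cost
              (value (transitionAllowed (z ℤ.+ ζ) (v + u)))
              (relax-cost _≟ₒ_ g (suc (toℕ c) , t + k , d ℕ.⊔ k , z ℤ.+ ζ) (v + u) ((t , d , z) , (k , ζ)))
              z≤n))
            z≤n))
        z≤n)

    bestTerminal-cost : ∀ {Y} → length layer ≤ Y → ∀ g → cost (bestTerminal g) ≤ Y * 10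
    bestTerminal-cost layer≤Y g = best-cost _>ℤ_ layer layer≤Y
      (λ (t , d , z) → read g (m , t , d , z) >>= λ e → isFinite e
        (λ (v , _) → op₂ ℕ._≤ᵇ_ v b >>= λ v≤b → op₂ ℕ._*_ 2 d >>= λ 2d → op₁ suc t >>= λ t+1 →
          op₂ ℕ._≤ᵇ_ 2d t+1 >>= λ cf → pure (if v≤b ∧ cf then just z else nothing))
        (pure nothing))
      λ (t , d , z) → s≤s (isFinite-cost (g (m , t , d , z)) {k = 4} (λ _ → ℕ.≤-refl) z≤n)

    backtrackInner-cost : ∀ H kζ X → cost (backtrackInner H kζ X) ≤ length (stages H) * 7 + 0
    backtrackInner-cost H kζ X = ℕ.+-monoˡ-≤ 0
      (for-const-cost (stages H) ℕ.≤-refl _ λ (i , h) (X , k , ζ) → s≤s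
        (isFinite-cost (h (k , ζ)) {k = 4} (λ (_ , packed) → if-cost packed ℕ.≤-refl z≤n) z≤n))

    backtrack-cost : ∀ Hs g s →
      cost (backtrack Hs g s) ≤ n + (sum (map (λ (c , H) → 3 + (length (stages H) * 7 + 0 + 0)) Hs) + 0)
    backtrack-cost Hs g s = ℕ.+-monoʳ-≤ n (ℕ.+-monoˡ-≤ 0
      (for-cost Hs _ (λ (c , H) → 2 + (length (stages H) * 7 + 0 + 0)) λ (c , H) (X , s) → s≤s
        (isFinite-cost (g (suc (toℕ c) , s))
          (λ (_ , s⁻ , kζ) → ℕ.+-monoˡ-≤ 0 (backtrackInner-cost H kζ X))
          z≤n)))

    outerProgram-cost : ∀ {N Y} → suc m ≤ N → length layer ≤ Y → ∀ Hs → length Hs ≤ N →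
      cost (outerProgram Hs) ≤
      N * Y + suc (N * 2 + sum (map (λ (c , H) → suc (Y * (3 + length (levels H) * 14))) Hs))
    outerProgram-cost {N} {Y} m<N layer≤Y Hs Hs≤N = ℕ.+-mono-≤
      (ℕ.≤-trans (ℕ.≤-reflexive (trans
          (length-cartesianProduct (upTo (suc m)) layer)
          (cong (_* length layer) (length-upTo (suc m)))))
        (ℕ.*-mono-≤ m<N layer≤Y))
      (s≤s (ℕ.+-mono-≤
        (for-const-cost Hs Hs≤N [] λ _ _ → ℕ.≤-refl)
        (ℕ.≤-trans
          (for-cost (value (for Hs [] (op₂ _∷_))) _ (λ (c , H) → Y * (3 + length (levels H) * 14))
            λ (c , H) g → outerStep-cost layer≤Y c H g)
          (sum-reversed bound Hs))))
      where
      bound : Fin m × Inner → ℕ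
      bound (c , H) = suc (Y * (3 + length (levels H) * 14))

    -- Total cost of the dynamic program

    module _ (m≤n : m ≤ n) where
      private
        -- `T` bounds the keys of one inner table, `Y` the states of one layer, and `M` is the
        -- leading order of the cost. The successors make all five positive, so that `M` dominates
        -- every lower-order term.
        N Z T Y M : ℕ
        N = suc n
        Z = suc (length 𝒵)
        T = N * Z
        Y = N * T
        M = Y * T

      length-layer : length layer ≤ Y
      length-layer = begin
        length layer                                                     ≡⟨ length-cartesianProduct (upTo N) (cartesianProduct (upTo N) 𝒵) ⟩
        length (upTo N) * length (cartesianProduct (upTo N) 𝒵)           ≡⟨ cong₂ _*_ (length-upTo N) (length-cartesianProduct (upTo N) 𝒵) ⟩
        N * (length (upTo N) * length 𝒵)                                 ≡⟨ cong (λ l → N * (l * length 𝒵)) (length-upTo N) ⟩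
        N * (N * length 𝒵)                                               ≤⟨ ℕ.*-monoʳ-≤ N (ℕ.*-monoʳ-≤ N (ℕ.n≤1+n _)) ⟩
        Y                                                                ∎
        where open ℕ.≤-Reasoning

      multiplicity≤n : ∀ c → multiplicity c ≤ n
      multiplicity≤n c = begin
        sum (map (λ i → indicator (κ i) c) items)  ≤⟨ sum-mono (λ i → indicator≤1 (κ i)) items ⟩
        sum (map (λ _ → 1) items)                  ≡⟨ sum-const 1 items ⟩
        length items * 1                           ≡⟨ ℕ.*-identityʳ _ ⟩
        length items                               ≤⟨ length-allFin≤ n ⟩
        n                                          ∎
        where
        open ℕ.≤-Reasoning
        indicator≤1 : ∀ c₀ → indicator c₀ c ≤ 1
        indicator≤1 c₀ with does (c₀ Fin.≟ c)
        ... | true  = ℕ.≤-refl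
        ... | false = z≤n

      innerPrograms-cost : cost innerPrograms ≤ N * suc (33 * Y + 1)
      innerPrograms-cost = for-const-cost (allFin m) (ℕ.≤-trans (length-allFin≤ m) (ℕ.m≤n⇒m≤1+n m≤n)) []
        λ c Hs → ℕ.+-monoˡ-≤ 1 (ℕ.≤-trans
          (innerProgram-cost {N} {T} c (ℕ.n≤1+n n)
            (ℕ.≤-trans (length-classItems c) (ℕ.m≤n⇒m≤1+n (multiplicity≤n c)))
            (ℕ.≤-trans (ℕ.≤-reflexive (length-levelKeys c)) (ℕ.*-mono-≤
              (s≤s (ℕ.≤-trans (classSize≤multiplicity c) (multiplicity≤n c))) (ℕ.n≤1+n _))))
          -- `T` unfolds to the successor of `length 𝒵 + n * Z`, which is the form that `polynomial`
          -- expects.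
          (polynomial n (length 𝒵 + n * Z)))
        where
        polynomial : ∀ n t → let N = suc n ; T = suc t in
          N * 5 + (T + suc (N * suc (T + (2 + T * 17) + 1) + (T * 4 + 0))) ≤ 33 * (N * T)
        -- The inequality is an identity with explicit slack. In terms of `N` and `T` the left side
        -- is `18 N T + 9 N + 5 T + 1`; 33 is the sum of these coefficients, so the constant terms
        -- in `n` and `t` cancel and the slack has nonnegative coefficients.
        polynomial n t = ℕ.m+n≤o⇒m≤o _ (ℕ.≤-reflexive (identity n t))
          where
          identity : ∀ n t → let N = suc n ; T = suc t in
            N * 5 + (T + suc (N * suc (T + (2 + T * 17) + 1) + (T * 4 + 0))) + (6 * n + 10 * t + 15 * (n * t))
            ≡ 33 * (N * T)
          identity = solve-∀

      length-innerPrograms : length (value innerPrograms) ≤ N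
      length-innerPrograms = begin
        length (value innerPrograms)              ≡⟨ trans (sum-const 1 (value innerPrograms)) (ℕ.*-identityʳ _) ⟨
        sum (map (λ _ → 1) (value innerPrograms)) ≤⟨ sum-innerPrograms (λ _ → 1) (λ _ → ℕ.≤-refl) ⟩
        sum (map (λ _ → 1) (allFin m))            ≡⟨ trans (sum-const 1 (allFin m)) (ℕ.*-identityʳ _) ⟩
        length (allFin m)                         ≤⟨ length-allFin≤ m ⟩
        m                                         ≤⟨ ℕ.m≤n⇒m≤1+n m≤n ⟩
        N                                         ∎
        where open ℕ.≤-Reasoning

      -- The classes jointly pay `n` times the number of levels, and the additional cardinality 0 of
      -- every color pays another `m ≤ n` times. Estimating each color by `T` would give `N * T`
      -- instead of `2 * T`.
      sum-levels : sum (map (λ (c , H) → length (levels H)) (value innerPrograms)) ≤ 2 * T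
      sum-levels = begin
        sum (map (λ (c , H) → length (levels H)) (value innerPrograms))     ≤⟨ sum-innerPrograms (λ H → length (levels H)) bound ⟩
        sum (map (λ c → z + z * multiplicity c) (allFin m))                 ≡⟨ sum-affine z z multiplicity (allFin m) ⟩
        length (allFin m) * z + z * sum (map multiplicity (allFin m))       ≤⟨ ℕ.+-mono-≤ (ℕ.*-monoˡ-≤ z (ℕ.≤-trans (length-allFin≤ m) m≤n)) (ℕ.*-monoʳ-≤ z sum-multiplicity) ⟩
        n * z + z * n                                                       ≤⟨ ℕ.m+n≤o⇒m≤o _ (ℕ.≤-reflexive (identity n z)) ⟩
        2 * T                                                               ∎
        where
        open ℕ.≤-Reasoning
        z = length 𝒵
        bound : ∀ c → length (levels (value (innerProgram c))) ≤ z + z * multiplicity c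
        bound c = begin
          length (levels (value (innerProgram c)))  ≤⟨ length-levels c ⟩
          z + classSize c * z                       ≡⟨ cong (z +_) (ℕ.*-comm (classSize c) z) ⟩
          z + z * classSize c                       ≤⟨ ℕ.+-monoʳ-≤ z (ℕ.*-monoʳ-≤ z (classSize≤multiplicity c)) ⟩
          z + z * multiplicity c                    ∎
        identity : ∀ n z → n * z + z * n + (2 + 2 * n + 2 * z) ≡ 2 * (suc n * suc z)
        identity = solve-∀

      sum-stages : sum (map (λ (c , H) → length (stages H)) (value innerPrograms)) ≤ N
      sum-stages = ℕ.≤-trans (sum-innerPrograms (λ H → length (stages H)) length-stages)
        (ℕ.m≤n⇒m≤1+n sum-multiplicity)

      outerSteps-cost :
        sum (map (λ (c , H) → suc (Y * (3 + length (levels H) * 14))) (value innerPrograms)) ≤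
        N * suc (Y * 3) + Y * 14 * (2 * T)
      outerSteps-cost = begin
        sum (map (λ (c , H) → suc (Y * (3 + length (levels H) * 14))) Hs)  ≤⟨ sum-mono (λ (c , H) → ℕ.≤-reflexive (distrib Y (length (levels H)))) Hs ⟩
        sum (map (λ (c , H) → suc (Y * 3) + Y * 14 * length (levels H)) Hs) ≡⟨ sum-affine (suc (Y * 3)) (Y * 14) (λ (c , H) → length (levels H)) Hs ⟩
        length Hs * suc (Y * 3) + Y * 14 * sum (map (λ (c , H) → length (levels H)) Hs) ≤⟨ ℕ.+-mono-≤ (ℕ.*-monoˡ-≤ (suc (Y * 3)) length-innerPrograms) (ℕ.*-monoʳ-≤ (Y * 14) sum-levels) ⟩
        N * suc (Y * 3) + Y * 14 * (2 * T) ∎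
        where
        open ℕ.≤-Reasoning
        Hs = value innerPrograms
        distrib : ∀ y l → suc (y * (3 + l * 14)) ≡ suc (y * 3) + y * 14 * l
        distrib = solve-∀

      backtracks-cost :
        sum (map (λ (c , H) → 3 + (length (stages H) * 7 + 0 + 0)) (value innerPrograms)) ≤ N * 3 + 7 * N
      backtracks-cost = begin
        sum (map (λ (c , H) → 3 + (length (stages H) * 7 + 0 + 0)) Hs)  ≤⟨ sum-mono (λ (c , H) → ℕ.≤-reflexive (tidy (length (stages H)))) Hs ⟩
        sum (map (λ (c , H) → 3 + 7 * length (stages H)) Hs)            ≡⟨ sum-affine 3 7 (λ (c , H) → length (stages H)) Hs ⟩
        length Hs * 3 + 7 * sum (map (λ (c , H) → length (stages H)) Hs) ≤⟨ ℕ.+-mono-≤ (ℕ.*-monoˡ-≤ 3 length-innerPrograms) (ℕ.*-monoʳ-≤ 7 sum-stages) ⟩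
        N * 3 + 7 * N ∎
        where
        open ℕ.≤-Reasoning
        Hs = value innerPrograms
        tidy : ∀ l → 3 + (l * 7 + 0 + 0) ≡ 3 + 7 * l
        tidy = solve-∀

      dynamicProgram-cost : cost dynamicProgram ≤ 100 * M
      dynamicProgram-cost = begin
        cost dynamicProgram
          ≤⟨ ℕ.+-mono-≤ innerPrograms-cost (ℕ.+-mono-≤
               (ℕ.≤-trans (outerProgram-cost {N} {Y} (s≤s m≤n) length-layer Hs length-innerPrograms)
                 (ℕ.+-monoʳ-≤ (N * Y) (s≤s (ℕ.+-monoʳ-≤ (N * 2) outerSteps-cost))))
               (ℕ.+-mono-≤ (bestTerminal-cost length-layer g)
                 (isFinite-cost (value (bestTerminal g)) {k = N + (N * 3 + 7 * N + 0)}
                   (λ (s , _) → ℕ.≤-trans (backtrack-cost Hs g s)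
                     (ℕ.+-mono-≤ (ℕ.n≤1+n n) (ℕ.+-monoˡ-≤ 0 backtracks-cost)))
                   (ℕ.≤-trans (ℕ.n≤1+n n) (ℕ.m≤m+n N _))))) ⟩
        N * suc (33 * Y + 1) + (N * Y + suc (N * 2 + (N * suc (Y * 3) + Y * 14 * (2 * T))) +
          (Y * 10 + suc (N + (N * 3 + 7 * N + 0))))
          -- 28 = 14 * 2: fourteen steps per transition, and at most `2 * T` levels over all colors.
          -- All remaining terms are at most a constant times `M`.
          ≡⟨ collect N T Y ⟩
        28 * M + (37 * (N * Y) + (10 * Y + (16 * N + 2)))
          ≤⟨ ℕ.+-monoʳ-≤ (28 * M) (ℕ.+-mono-≤ (ℕ.*-monoʳ-≤ 37 NY≤M)
               (ℕ.+-mono-≤ (ℕ.*-monoʳ-≤ 10 Y≤M) (ℕ.+-mono-≤ (ℕ.*-monoʳ-≤ 16 N≤M) (ℕ.*-monoʳ-≤ 2 1≤M)))) ⟩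
        28 * M + (37 * M + (10 * M + (16 * M + 2 * M)))
          ≡⟨ total M ⟩
        93 * M
          ≤⟨ ℕ.*-monoˡ-≤ M {93} {100} (ℕ.m≤m+n 93 7) ⟩
        100 * M ∎
        where
        open ℕ.≤-Reasoning
        Hs = value innerPrograms
        g = value (outerProgram Hs)
        collect : ∀ N T Y →
          N * suc (33 * Y + 1) + (N * Y + suc (N * 2 + (N * suc (Y * 3) + Y * 14 * (2 * T))) +
            (Y * 10 + suc (N + (N * 3 + 7 * N + 0)))) ≡
          28 * (Y * T) + (37 * (N * Y) + (10 * Y + (16 * N + 2)))
        collect = solve-∀
        total : ∀ M → 28 * M + (37 * M + (10 * M + (16 * M + 2 * M))) ≡ 93 * M
        total = solve-∀
        N≤T : N ≤ T
        N≤T = ℕ.m≤m*n N Z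
        T≤M : T ≤ M
        T≤M = ℕ.m≤n*m T Y
        NY≤M : N * Y ≤ M
        NY≤M = ℕ.≤-trans (ℕ.≤-reflexive (ℕ.*-comm N Y)) (ℕ.*-monoʳ-≤ Y N≤T)
        Y≤M : Y ≤ M
        Y≤M = ℕ.m≤m*n Y T
        N≤M : N ≤ M
        N≤M = ℕ.≤-trans N≤T T≤M
        1≤M : 1 ≤ M
        1≤M = ℕ.≤-trans (s≤s z≤n) N≤M

-- Integers as rationals, rounding and division

-- `z ℚ./ 1` normalises by a gcd that is stuck for a variable `z`. The arithmetic of `fromℤ` is
-- therefore derived from unnormalised rationals, where the denominator is literally 1.
toℚᵘ-fromℤ : ∀ z → ℚ.toℚᵘ (fromℤ z) ℚᵘ.≃ ℚᵘ.mkℚᵘ z 0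
toℚᵘ-fromℤ z = ℚ.toℚᵘ-fromℚᵘ (ℚᵘ.mkℚᵘ z 0)

fromℤ-homo-+ : ∀ x y → fromℤ (x ℤ.+ y) ≡ fromℤ x ℚ.+ fromℤ y
fromℤ-homo-+ x y = ℚ.toℚᵘ-injective (begin-equality
  ℚ.toℚᵘ (fromℤ (x ℤ.+ y))                   ≃⟨ toℚᵘ-fromℤ (x ℤ.+ y) ⟩
  ℚᵘ.mkℚᵘ (x ℤ.+ y) 0                        ≃⟨ ℚᵘ.*≡* (cong (ℤ._* ℤ.+ 1) (cong₂ ℤ._+_ (ℤ.*-identityʳ x) (ℤ.*-identityʳ y))) ⟨
  ℚᵘ.mkℚᵘ x 0 ℚᵘ.+ ℚᵘ.mkℚᵘ y 0               ≃⟨ ℚᵘ.+-cong (toℚᵘ-fromℤ x) (toℚᵘ-fromℤ y) ⟨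
  ℚ.toℚᵘ (fromℤ x) ℚᵘ.+ ℚ.toℚᵘ (fromℤ y)     ≃⟨ ℚ.toℚᵘ-homo-+ (fromℤ x) (fromℤ y) ⟨
  ℚ.toℚᵘ (fromℤ x ℚ.+ fromℤ y)               ∎)
  where open ℚᵘ.≤-Reasoning

fromℤ-homo-* : ∀ x y → fromℤ (x ℤ.* y) ≡ fromℤ x ℚ.* fromℤ y
fromℤ-homo-* x y = ℚ.toℚᵘ-injective (begin-equality
  ℚ.toℚᵘ (fromℤ (x ℤ.* y))                   ≃⟨ toℚᵘ-fromℤ (x ℤ.* y) ⟩
  ℚᵘ.mkℚᵘ x 0 ℚᵘ.* ℚᵘ.mkℚᵘ y 0               ≃⟨ ℚᵘ.*-cong (toℚᵘ-fromℤ x) (toℚᵘ-fromℤ y) ⟨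
  ℚ.toℚᵘ (fromℤ x) ℚᵘ.* ℚ.toℚᵘ (fromℤ y)     ≃⟨ ℚ.toℚᵘ-homo-* (fromℤ x) (fromℤ y) ⟨
  ℚ.toℚᵘ (fromℤ x ℚ.* fromℤ y)               ∎)
  where open ℚᵘ.≤-Reasoning

fromℤ-homo-neg : ∀ x → fromℤ (ℤ.- x) ≡ ℚ.- fromℤ x
fromℤ-homo-neg x = ℚ.toℚᵘ-injective (begin-equality
  ℚ.toℚᵘ (fromℤ (ℤ.- x))     ≃⟨ toℚᵘ-fromℤ (ℤ.- x) ⟩
  ℚᵘ.- ℚᵘ.mkℚᵘ x 0           ≃⟨ ℚᵘ.-‿cong (toℚᵘ-fromℤ x) ⟨
  ℚᵘ.- ℚ.toℚᵘ (fromℤ x)      ≃⟨ ℚ.toℚᵘ-homo‿- (fromℤ x) ⟨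
  ℚ.toℚᵘ (ℚ.- fromℤ x)       ∎)
  where open ℚᵘ.≤-Reasoning

fromℤ-mono-≤ : ∀ {x y} → x ℤ.≤ y → fromℤ x ℚ.≤ fromℤ y
fromℤ-mono-≤ {x} {y} x≤y = ℚ.toℚᵘ-cancel-≤ (begin
  ℚ.toℚᵘ (fromℤ x)  ≃⟨ toℚᵘ-fromℤ x ⟩
  ℚᵘ.mkℚᵘ x 0       ≤⟨ ℚᵘ.*≤* (ℤ.*-monoʳ-≤-nonNeg (ℤ.+ 1) x≤y) ⟩
  ℚᵘ.mkℚᵘ y 0       ≃⟨ toℚᵘ-fromℤ y ⟨
  ℚ.toℚᵘ (fromℤ y)  ∎)
  where open ℚᵘ.≤-Reasoning

fromℤ-mono-< : ∀ {x y} → x ℤ.< y → fromℤ x ℚ.< fromℤ y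
fromℤ-mono-< {x} {y} x<y = ℚ.toℚᵘ-cancel-< (begin-strict
  ℚ.toℚᵘ (fromℤ x)  ≃⟨ toℚᵘ-fromℤ x ⟩
  ℚᵘ.mkℚᵘ x 0       <⟨ ℚᵘ.*<* (ℤ.*-monoʳ-<-pos (ℤ.+ 1) x<y) ⟩
  ℚᵘ.mkℚᵘ y 0       ≃⟨ toℚᵘ-fromℤ y ⟨
  ℚ.toℚᵘ (fromℤ y)  ∎)
  where open ℚᵘ.≤-Reasoning

fromℕ-homo-+ : ∀ j k → fromℕ (j + k) ≡ fromℕ j ℚ.+ fromℕ k
fromℕ-homo-+ j k = fromℤ-homo-+ (ℤ.+ j) (ℤ.+ k)

fromℕ-homo-* : ∀ j k → fromℕ (j * k) ≡ fromℕ j ℚ.* fromℕ k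
fromℕ-homo-* j k = trans (cong fromℤ (ℤ.pos-* j k)) (fromℤ-homo-* (ℤ.+ j) (ℤ.+ k))

fromℕ-mono-≤ : ∀ {j k} → j ≤ k → fromℕ j ℚ.≤ fromℕ k
fromℕ-mono-≤ j≤k = fromℤ-mono-≤ (ℤ.+≤+ j≤k)

fromℕ-nonNeg : ∀ k → ℚ.NonNegative (fromℕ k)
fromℕ-nonNeg k = ℚ.nonNegative (fromℕ-mono-≤ {0} {k} z≤n)

p≤⌊p⌋+1 : ∀ p → p ℚ.≤ fromℤ (ℚ.floor p) ℚ.+ 1ℚ
-- Matching on the record lets `ℚ.floor` compute. After clearing the denominator, the claim is the
-- bound on the remainder of integer division.
p≤⌊p⌋+1 p@record{} = subst (p ℚ.≤_) (fromℤ-homo-+ ⌊p⌋ (ℤ.+ 1)) (ℚ.toℚᵘ-cancel-≤ (begin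
  ℚ.toℚᵘ p                        ≤⟨ ℚᵘ.*≤* numerator≤ ⟩
  ℚᵘ.mkℚᵘ (⌊p⌋ ℤ.+ ℤ.+ 1) 0       ≃⟨ toℚᵘ-fromℤ (⌊p⌋ ℤ.+ ℤ.+ 1) ⟨
  ℚ.toℚᵘ (fromℤ (⌊p⌋ ℤ.+ ℤ.+ 1))  ∎))
  where
  open ℚᵘ.≤-Reasoning
  ⌊p⌋ = ℚ.floor p
  numerator≤ : ℚ.↥ p ℤ.* ℤ.+ 1 ℤ.≤ (⌊p⌋ ℤ.+ ℤ.+ 1) ℤ.* ℚ.↧ p
  numerator≤ = subst₂ ℤ._≤_ (sym (ℤ.*-identityʳ (ℚ.↥ p)))
    (cong (ℤ._* ℚ.↧ p) (trans (cong ℤ.suc (sym (ℤ.div-pos-is-/ℕ (ℚ.↥ p) (ℚ.↧ₙ p)))) (ℤ.+-comm (ℤ.+ 1) ⌊p⌋)))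
    (ℤ.<⇒≤ (ℤ.n<s[n/ℕd]*d (ℚ.↥ p) (ℚ.↧ₙ p)))

⌈p⌉≤p+1 : ∀ p → fromℤ (ℚ.ceiling p) ℚ.≤ p ℚ.+ 1ℚ
⌈p⌉≤p+1 p@record{} = begin
  fromℤ (ℤ.- ⌊-p⌋)                     ≡⟨ fromℤ-homo-neg ⌊-p⌋ ⟩
  ℚ.- fromℤ ⌊-p⌋                       ≡⟨ solve 2 (λ f p → :- f := (:- p) :+ (p :- f)) refl (fromℤ ⌊-p⌋) p ⟩
  ℚ.- p ℚ.+ (p ℚ.- fromℤ ⌊-p⌋)         ≤⟨ ℚ.+-monoˡ-≤ (p ℚ.- fromℤ ⌊-p⌋) (p≤⌊p⌋+1 (ℚ.- p)) ⟩
  fromℤ ⌊-p⌋ ℚ.+ 1ℚ ℚ.+ (p ℚ.- fromℤ ⌊-p⌋) ≡⟨ solve 3 (λ f p o → f :+ o :+ (p :- f) := p :+ o) refl (fromℤ ⌊-p⌋) p 1ℚ ⟩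
  p ℚ.+ 1ℚ                             ∎
  where
  open ℚ.≤-Reasoning
  open +-*-Solver
  ⌊-p⌋ = ℚ.floor (ℚ.- p)

÷₀-* : ∀ x {y} → 0ℚ ℚ.< y → (x ÷₀ y) ℚ.* y ≡ x
÷₀-* x {y} 0<y with y ℚ.≟ 0ℚ
... | yes y≡0 = contradiction (sym y≡0) (ℚ.<⇒≢ 0<y)
... | no  y≢0 = begin
  x ℚ.* ℚ.1/ y ℚ.* y    ≡⟨ ℚ.*-assoc x (ℚ.1/ y) y ⟩
  x ℚ.* (ℚ.1/ y ℚ.* y)  ≡⟨ cong (x ℚ.*_) (ℚ.*-inverseˡ y) ⟩
  x ℚ.* 1ℚ              ≡⟨ ℚ.*-identityʳ x ⟩
  x                     ∎
  where
  open ≡-Reasoning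
  instance _ = ℚ.≢-nonZero y≢0

≤-÷₀ : ∀ {t x y} → 0ℚ ℚ.< y → t ℚ.* y ℚ.≤ x → t ℚ.≤ x ÷₀ y
≤-÷₀ {t} {x} {y} 0<y ty≤x = ℚ.*-cancelʳ-≤-pos y ⦃ ℚ.positive 0<y ⦄
  (subst (t ℚ.* y ℚ.≤_) (sym (÷₀-* x 0<y)) ty≤x)

*-pos : ∀ {x y} → 0ℚ ℚ.< x → 0ℚ ℚ.< y → 0ℚ ℚ.< x ℚ.* y
*-pos {x} {y} 0<x 0<y = subst (ℚ._< x ℚ.* y) (ℚ.*-zeroˡ y) (ℚ.*-monoˡ-<-pos y ⦃ ℚ.positive 0<y ⦄ 0<x)

÷₀-pos : ∀ {x y} → 0ℚ ℚ.< x → 0ℚ ℚ.< y → 0ℚ ℚ.< x ÷₀ y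
÷₀-pos {x} {y} 0<x 0<y = ℚ.*-cancelʳ-<-nonNeg y ⦃ ℚ.pos⇒nonNeg y ⦃ ℚ.positive 0<y ⦄ ⦄
  (subst₂ ℚ._<_ (sym (ℚ.*-zeroˡ y)) (sym (÷₀-* x 0<y)) 0<x)

-- The chain is `t ε² ≤ k (z ε)² ≤ k b² ≤ x`. It is applied with `z` the level count and `k` of
-- order `n³`.
quadratic-bound : ∀ {ε t z} k {b x} → 0ℚ ℚ.< ε → t ≤ k * (z * z) → fromℕ z ℚ.* ε ℚ.≤ fromℕ b →
                  k * (b * b) ≤ x → fromℕ t ℚ.≤ fromℕ x ÷₀ (ε ℚ.* ε)
quadratic-bound {ε} {t} {z} k {b} {x} 0<ε t≤ zε≤b ≤x = ≤-÷₀ (*-pos 0<ε 0<ε) (begin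
  fromℕ t ℚ.* (ε ℚ.* ε)                              ≤⟨ ℚ.*-monoʳ-≤-nonNeg (ε ℚ.* ε) ⦃ ℚ.nonNegative (ℚ.<⇒≤ (*-pos 0<ε 0<ε)) ⦄ (fromℕ-mono-≤ t≤) ⟩
  fromℕ (k * (z * z)) ℚ.* (ε ℚ.* ε)                  ≡⟨ cong (ℚ._* (ε ℚ.* ε)) (homo z) ⟩
  fromℕ k ℚ.* (fromℕ z ℚ.* fromℕ z) ℚ.* (ε ℚ.* ε)    ≡⟨ solve 3 (λ k z e → k :* (z :* z) :* (e :* e) := k :* ((z :* e) :* (z :* e))) refl (fromℕ k) (fromℕ z) ε ⟩
  fromℕ k ℚ.* (fromℕ z ℚ.* ε ℚ.* (fromℕ z ℚ.* ε))    ≤⟨ ℚ.*-monoˡ-≤-nonNeg (fromℕ k) ⦃ fromℕ-nonNeg k ⦄ square≤ ⟩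
  fromℕ k ℚ.* (fromℕ b ℚ.* fromℕ b)                  ≡⟨ homo b ⟨
  fromℕ (k * (b * b))                                ≤⟨ fromℕ-mono-≤ ≤x ⟩
  fromℕ x                                            ∎)
  where
  open ℚ.≤-Reasoning
  open +-*-Solver using (solve; _:*_; _:=_)
  homo : ∀ z → fromℕ (k * (z * z)) ≡ fromℕ k ℚ.* (fromℕ z ℚ.* fromℕ z)
  homo z = trans (fromℕ-homo-* k (z * z)) (cong (fromℕ k ℚ.*_) (fromℕ-homo-* z z))
  nonNeg : ℚ.NonNegative (fromℕ z ℚ.* ε)
  nonNeg = ℚ.nonNeg*nonNeg⇒nonNeg (fromℕ z) ⦃ fromℕ-nonNeg z ⦄ ε ⦃ ℚ.nonNegative (ℚ.<⇒≤ 0<ε) ⦄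
  square≤ : fromℕ z ℚ.* ε ℚ.* (fromℕ z ℚ.* ε) ℚ.≤ fromℕ b ℚ.* fromℕ b
  square≤ = ℚ.≤-trans
    (ℚ.*-monoˡ-≤-nonNeg (fromℕ z ℚ.* ε) ⦃ nonNeg ⦄ zε≤b)
    (ℚ.*-monoʳ-≤-nonNeg (fromℕ b) ⦃ fromℕ-nonNeg b ⦄ zε≤b)

-- Number of levels in a rounded profit range

-- The 4 consists of one unit for rounding at each end, one because both ends belong to the
-- interval, and one for the outer successor; `ε < 1` keeps it at most 4 after multiplication.
length-interval : ∀ {ε lo hi k} q q′ → 0ℚ ℚ.< ε → ε ℚ.< 1ℚ →
  q ℚ.≤ fromℤ lo ℚ.+ 1ℚ → fromℤ hi ℚ.≤ q′ ℚ.+ 1ℚ → (q′ ℚ.- q) ℚ.* ε ℚ.≤ fromℕ k →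
  fromℕ (suc (length (interval lo hi))) ℚ.* ε ℚ.≤ fromℕ (k + 4)
length-interval {ε} {lo} {hi} {k} q q′ 0<ε ε<1 q≤ ≤q′ gap≤ with hi ℤ.- lo in eq
... | ℤ.+ j = begin
  fromℕ (suc (length (map (λ j → lo ℤ.+ ℤ.+ j) (upTo (suc j))))) ℚ.* ε
    ≡⟨ cong (λ l → fromℕ (suc l) ℚ.* ε) (trans (length-map (λ j → lo ℤ.+ ℤ.+ j) (upTo (suc j))) (length-upTo (suc j))) ⟩
  fromℕ (2 + j) ℚ.* ε
    ≡⟨ cong (λ x → fromℕ x ℚ.* ε) (ℕ.+-comm 2 j) ⟩
  fromℕ (j + 2) ℚ.* ε
    ≡⟨ cong (ℚ._* ε) (trans (fromℕ-homo-+ j 2) (cong (ℚ._+ fromℕ 2) j≡)) ⟩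
  (fromℤ hi ℚ.- fromℤ lo ℚ.+ fromℕ 2) ℚ.* ε
    ≤⟨ ℚ.*-monoʳ-≤-nonNeg ε ⦃ ℚ.nonNegative (ℚ.<⇒≤ 0<ε) ⦄ (begin
        fromℤ hi ℚ.- fromℤ lo ℚ.+ fromℕ 2                        ≡⟨ solve 4 (λ h l q t → h :- l :+ t := h :+ (q :- l :- q) :+ t) refl (fromℤ hi) (fromℤ lo) q (fromℕ 2) ⟩
        fromℤ hi ℚ.+ (q ℚ.- fromℤ lo ℚ.- q) ℚ.+ fromℕ 2          ≤⟨ ℚ.+-monoˡ-≤ (fromℕ 2) (ℚ.+-mono-≤ ≤q′ (ℚ.+-monoˡ-≤ (ℚ.- q) (ℚ.+-monoˡ-≤ (ℚ.- fromℤ lo) q≤))) ⟩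
        q′ ℚ.+ 1ℚ ℚ.+ (fromℤ lo ℚ.+ 1ℚ ℚ.- fromℤ lo ℚ.- q) ℚ.+ fromℕ 2 ≡⟨ solve 3 (λ q′ l q → q′ :+ con 1ℚ :+ (l :+ con 1ℚ :- l :- q) :+ con (fromℕ 2) := q′ :- q :+ con (fromℕ 4)) refl q′ (fromℤ lo) q ⟩
        q′ ℚ.- q ℚ.+ fromℕ 4 ∎) ⟩
  (q′ ℚ.- q ℚ.+ fromℕ 4) ℚ.* ε
    ≡⟨ ℚ.*-distribʳ-+ ε (q′ ℚ.- q) (fromℕ 4) ⟩
  (q′ ℚ.- q) ℚ.* ε ℚ.+ fromℕ 4 ℚ.* ε
    ≤⟨ ℚ.+-mono-≤ gap≤ (ℚ.*-monoˡ-≤-nonNeg (fromℕ 4) (ℚ.<⇒≤ ε<1)) ⟩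
  fromℕ k ℚ.+ fromℕ 4 ℚ.* 1ℚ
    ≡⟨ fromℕ-homo-+ k 4 ⟨
  fromℕ (k + 4) ∎
  where
  open ℚ.≤-Reasoning
  open +-*-Solver using (solve; con; _:+_; _:-_; _:=_)
  j≡ : fromℕ j ≡ fromℤ hi ℚ.- fromℤ lo
  j≡ = trans (cong fromℤ (sym eq)) (trans (fromℤ-homo-+ hi (ℤ.- lo)) (cong (fromℤ hi ℚ.+_) (fromℤ-homo-neg lo)))
-- For an empty interval only the outer successor remains.
... | ℤ.-[1+ j ] = begin
  fromℕ 1 ℚ.* ε  ≡⟨ ℚ.*-identityˡ ε ⟩
  ε              ≤⟨ ℚ.<⇒≤ ε<1 ⟩
  fromℕ 1        ≤⟨ fromℕ-mono-≤ (ℕ.≤-trans (s≤s z≤n) (ℕ.m≤n+m 4 k)) ⟩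
  fromℕ (k + 4)  ∎
  where open ℚ.≤-Reasoning

-- Multiplying by `n` turns `step` into `ε LB`, after which the positive factor `LB` cancels.
scaled-gap : ∀ {ε LB n k} q → 0ℚ ℚ.< ε → 0ℤ ℤ.< LB → 0 ℕ.< n →
  let step = (ε ℚ.* fromℤ LB) ÷₀ fromℕ n in
  q ℚ.* step ℚ.≤ fromℕ k ℚ.* fromℤ LB → q ℚ.* ε ℚ.≤ fromℕ (k * n)
scaled-gap {ε} {LB} {n} {k} q 0<ε 0<LB 0<n q≤ = ℚ.*-cancelʳ-≤-pos Λ ⦃ ℚ.positive (fromℤ-mono-< 0<LB) ⦄ (begin
  q ℚ.* ε ℚ.* Λ               ≡⟨ ℚ.*-assoc q ε Λ ⟩
  q ℚ.* (ε ℚ.* Λ)             ≡⟨ cong (q ℚ.*_) (÷₀-* (ε ℚ.* Λ) (fromℤ-mono-< (ℤ.+<+ 0<n))) ⟨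
  q ℚ.* (step ℚ.* fromℕ n)    ≡⟨ ℚ.*-assoc q step (fromℕ n) ⟨
  q ℚ.* step ℚ.* fromℕ n      ≤⟨ ℚ.*-monoʳ-≤-nonNeg (fromℕ n) ⦃ fromℕ-nonNeg n ⦄ q≤ ⟩
  fromℕ k ℚ.* Λ ℚ.* fromℕ n   ≡⟨ solve 3 (λ k l n → k :* l :* n := k :* n :* l) refl (fromℕ k) Λ (fromℕ n) ⟩
  fromℕ k ℚ.* fromℕ n ℚ.* Λ   ≡⟨ cong (ℚ._* Λ) (fromℕ-homo-* k n) ⟨
  fromℕ (k * n) ℚ.* Λ         ∎)
  where
  open ℚ.≤-Reasoning
  open +-*-Solver using (solve; _:*_; _:=_)
  Λ = fromℤ LB
  step = (ε ℚ.* Λ) ÷₀ fromℕ n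

-- Profit of the set returned by LP-Round

-- The head of the list plays the incumbent: after comparing `a` with `a′`, the search continues
-- exactly like a search started on the winner followed by `as`. This makes the induction go through
-- without a statement about general loop states.
best-max : ∀ (f : A → ℤ) a as → let score = λ a → charge 1 (f a) >>= λ v → pure (just v) in
  ∃ λ r → value (best _>ℤ_ (a ∷ as) score) ≡ just (r , f r) × All (λ a → f a ℤ.≤ f r) (a ∷ as)
best-max f a [] = a , refl , ℤ.≤-refl ∷ []
best-max f a (a′ ∷ as) with f a′ ℤ.≤ᵇ f a in eq
... | true with r , best≡ , a≤r ∷ as≤r ← best-max f a as =
  r , best≡ , a≤r ∷ ℤ.≤-trans (ℤ.≤ᵇ⇒≤ (subst Bool.T (sym eq) tt)) a≤r ∷ as≤r
... | false with r , best≡ , a′≤r ∷ as≤r ← best-max f a′ as =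
  r , best≡ , ℤ.≤-trans (ℤ.<⇒≤ (ℤ.≰⇒> λ a′≤a → subst Bool.T eq (ℤ.≤⇒≤ᵇ a′≤a))) a′≤r ∷ a′≤r ∷ as≤r

best-max-∈ : ∀ (f : A → ℤ) as → (∀ a → a ∈ as) → A → let score = λ a → charge 1 (f a) >>= λ v → pure (just v) in
  ∃ λ r → value (best _>ℤ_ as score) ≡ just (r , f r) × ∀ a → f a ℤ.≤ f r
best-max-∈ f []       ∈as a = contradiction (∈as a) λ ()
best-max-∈ f (a ∷ as) ∈as _ with r , best≡ , as≤r ← best-max f a as =
  r , best≡ , λ a → All.lookup as≤r (∈as a)

lookup-⁅⁆ : ∀ {n} (r i : Fin n) → lookup ⁅ r ⁆ i ≡ does (r Fin.≟ i)
lookup-⁅⁆ Fin.zero    Fin.zero    = refl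
lookup-⁅⁆ Fin.zero    (Fin.suc i) = lookup-replicate i false
lookup-⁅⁆ (Fin.suc r) Fin.zero    = refl
lookup-⁅⁆ (Fin.suc r) (Fin.suc i) = lookup-⁅⁆ r i

module _ (I : Instance) where
  open Instance I
  open Sets I

  private
    addProfit : Subset n → Fin n → ℤ → Timed ℤ
    addProfit X i s = member X i >>= λ i∈X →
      if i∈X then (read p i >>= λ pᵢ → op₂ ℤ._+_ s pᵢ) else pure s

  sum-⁅⁆-∉ : ∀ {r is} → All (r ≢_) is → ∀ s → value (for is s (addProfit ⁅ r ⁆)) ≡ s
  sum-⁅⁆-∉ [] s = refl
  sum-⁅⁆-∉ {r} (_∷_ {x = i} r≢i r∉is) s rewrite lookup-⁅⁆ r i with r Fin.≟ i
  ... | yes r≡i = contradiction r≡i r≢i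
  ... | no  _   = sum-⁅⁆-∉ r∉is s

  -- Absence of duplicates ensures that `p r` is added exactly once.
  sum-⁅⁆-∈ : ∀ {r is} → Unique is → r ∈ is → ∀ s → value (for is s (addProfit ⁅ r ⁆)) ≡ s ℤ.+ p r
  sum-⁅⁆-∈ {r} (_∷_ {x = i} i∉is unique) r∈ s rewrite lookup-⁅⁆ r i with r Fin.≟ i | r∈
  ... | yes refl | _          = sum-⁅⁆-∉ i∉is (s ℤ.+ p r)
  ... | no  r≢i  | here r≡i   = contradiction r≡i r≢i
  ... | no  _    | there r∈is = sum-⁅⁆-∈ unique r∈is s

  profit-⁅⁆ : ∀ r → value (profit ⁅ r ⁆) ≡ p r
  profit-⁅⁆ r = trans (sum-⁅⁆-∈ (allFin⁺ n) (∈-allFin r) 0ℤ) (ℤ.+-identityˡ (p r))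

  mostProfitableItem-max : Fin n → ∃ λ r → value mostProfitableItem ≡ just (r , p r) × ∀ i → p i ℤ.≤ p r
  mostProfitableItem-max = best-max-∈ p items ∈-allFin

  module _ (lp : LPSolver) where
    open LPRound lp I

    p≤profit-lpRound : ∀ {r} → value mostProfitableItem ≡ just (r , p r) →
                       p r ℤ.≤ value (profit (value lpRound))
    p≤profit-lpRound {r} best≡ = betterOf _ best≡
      where
      S₀ = value (repair (value (roundDown (value (lp I)))))
      -- The result of the search is generalised to a variable `x`, so that the equation can be
      -- matched with `refl` and the choice between `S₀` and the singleton reduces.
      betterOf : ∀ x → x ≡ just (r , p r) → p r ℤ.≤ value (profit (value (isFinite x
        (λ (r , pᵣ) → profit S₀ >>= λ P → op₂ ℤ._≤ᵇ_ pᵣ P >>= λ S₀≥ → if S₀≥ then pure S₀ else singleton r)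
        (pure S₀))))
      betterOf x refl with p r ℤ.≤ᵇ value (profit S₀) in eq
      ... | true  = ℤ.≤ᵇ⇒≤ (subst Bool.T (sym eq) tt)
      ... | false = ℤ.≤-reflexive (sym (profit-⁅⁆ r))

    module _ (ε : ℚ) where
      open F2 lp I ε

      maxProfit-max : ∀ {r} → value mostProfitableItem ≡ just (r , p r) → value maxProfit ≡ p r
      maxProfit-max {r} best≡ = theMax _ best≡
        where
        theMax : ∀ x → x ≡ just (r , p r) →
                 value (isFinite x (λ (_ , pᵣ) → pure pᵣ) (pure 0ℤ)) ≡ p r
        theMax x refl = refl

      allNonnegative-true : (∀ i → 0ℤ ℤ.≤ p i) → value allNonnegative ≡ true
      allNonnegative-true p≥0 = all-true items
        where
        all-true : ∀ is → value (for is true λ i acc →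
          read p i >>= λ pᵢ → op₂ ℤ._≤ᵇ_ 0ℤ pᵢ >>= λ ≥0 → op₂ _∧_ acc ≥0) ≡ true
        all-true [] = refl
        all-true (i ∷ is) with 0ℤ ℤ.≤ᵇ p i | ℤ.≤⇒≤ᵇ (p≥0 i)
        ... | true | _ = all-true is

      scaledProfits-cost : ∀ step → cost (scaledProfits step) ≤ n + n * 5
      scaledProfits-cost step = ℕ.+-mono-≤ (length-allFin≤ n)
        (for-const-cost items (length-allFin≤ n) _ λ _ _ → ℕ.≤-refl)

      profitRange-cost : ∀ step UB → cost (profitRange step UB) ≤ n * 4 + (n * 5 + 1 + 7)
      profitRange-cost step UB = ℕ.+-mono-≤
        (for-const-cost items (length-allFin≤ n) true λ _ _ → ℕ.≤-refl)
        (if-cost (value allNonnegative) (ℕ.≤-trans (ℕ.m≤m+n 2 5) (ℕ.m≤n+m 7 (n * 5 + 1)))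
          (ℕ.+-monoˡ-≤ 7 (ℕ.+-mono-≤ (mostProfitableItem-cost I)
            (isFinite-cost (value mostProfitableItem) (λ _ → z≤n) z≤n))))

-- Running time in terms of the number of levels

-- The 8 comes from replacing each of three factors `n + 1` by `2 n`. The exact coefficient of `Q`
-- would be `L + 57 + 19 + 800`, which `(200 + L) * 8` rounds up.
total-cost≤ : ∀ {n m L Z l t r} → 0 ℕ.< n → 0 ℕ.< Z → m ≤ n → l ≤ L * n →
  r ≡ l + (n + n * 4 + (m + n * 6 + (m * 5 + suc (n * 3 + (3 + (n * 8 + 2)))) + (n * 5 + suc (n * 4 + suc n)))) →
  t ≤ r + (n * 4 + (3 + (n + n * 5 + (n * 4 + (n * 5 + 1 + 7) + 100 * (suc n * (suc n * Z) * (suc n * Z)))))) →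
  t ≤ (200 + L) * 8 * (n * (n * n)) * (Z * Z)
total-cost≤ {n} {m} {L} {Z} {l} {t} 0<n 0<Z m≤n l≤ refl t≤ = ℕ.≤-trans t≤ (begin
  _
    ≤⟨ ℕ.+-mono-≤ (ℕ.+-mono-≤ l≤ (ℕ.+-monoʳ-≤ (n + n * 4)
         (ℕ.+-monoˡ-≤ _ (ℕ.+-mono-≤ (ℕ.+-monoˡ-≤ (n * 6) m≤n) (ℕ.+-monoˡ-≤ _ (ℕ.*-monoˡ-≤ 5 m≤n))))))
       (ℕ.+-monoʳ-≤ (n * 4) (ℕ.+-monoʳ-≤ 3 (ℕ.+-monoʳ-≤ (n + n * 5) (ℕ.+-monoʳ-≤ (n * 4 + (n * 5 + 1 + 7)) (ℕ.*-monoʳ-≤ 100 M≤8Q))))) ⟩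
  L * n + (n + n * 4 + (n + n * 6 + (n * 5 + suc (n * 3 + (3 + (n * 8 + 2)))) + (n * 5 + suc (n * 4 + suc n))))
    + (n * 4 + (3 + (n + n * 5 + (n * 4 + (n * 5 + 1 + 7) + 100 * (8 * Q)))))
    ≡⟨ collect L n (100 * (8 * Q)) ⟩
  L * n + (57 * n + (19 + 100 * (8 * Q)))
    ≤⟨ ℕ.+-mono-≤ (ℕ.*-monoʳ-≤ L n≤Q) (ℕ.+-mono-≤ (ℕ.*-monoʳ-≤ 57 n≤Q)
         (ℕ.+-monoˡ-≤ (100 * (8 * Q)) (ℕ.*-monoʳ-≤ 19 (ℕ.≤-trans 0<n n≤Q)))) ⟩
  L * Q + (57 * Q + (19 * Q + 100 * (8 * Q)))
    ≤⟨ ℕ.m+n≤o⇒m≤o _ (ℕ.≤-reflexive (total L Q)) ⟩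
  (200 + L) * 8 * Q
    ≡⟨ ℕ.*-assoc ((200 + L) * 8) (n * (n * n)) (Z * Z) ⟨
  (200 + L) * 8 * (n * (n * n)) * (Z * Z) ∎)
  where
  open ℕ.≤-Reasoning
  instance
    _ = ℕ.>-nonZero 0<n
    _ = ℕ.>-nonZero 0<Z
    _ = ℕ.m*n≢0 n n
    _ = ℕ.m*n≢0 Z Z
  Q = n * (n * n) * (Z * Z)
  n≤Q : n ≤ Q
  n≤Q = ℕ.≤-trans (ℕ.m≤m*n n (n * n)) (ℕ.m≤m*n (n * (n * n)) (Z * Z))
  1+n≤2n : suc n ≤ 2 * n
  1+n≤2n = ℕ.≤-trans (ℕ.+-monoˡ-≤ n 0<n) (ℕ.≤-reflexive (cong (n +_) (sym (ℕ.+-identityʳ n))))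
  M≤8Q : suc n * (suc n * Z) * (suc n * Z) ≤ 8 * Q
  M≤8Q = ℕ.≤-trans
    (ℕ.*-mono-≤ (ℕ.*-mono-≤ 1+n≤2n (ℕ.*-monoˡ-≤ Z 1+n≤2n)) (ℕ.*-monoˡ-≤ Z 1+n≤2n))
    (ℕ.≤-reflexive (cube n Z))
    where
    cube : ∀ n z → 2 * n * (2 * n * z) * (2 * n * z) ≡ 8 * (n * (n * n) * (z * z))
    cube = solve-∀
  collect : ∀ l n x →
    l * n + (n + n * 4 + (n + n * 6 + (n * 5 + suc (n * 3 + (3 + (n * 8 + 2)))) + (n * 5 + suc (n * 4 + suc n))))
      + (n * 4 + (3 + (n + n * 5 + (n * 4 + (n * 5 + 1 + 7) + x))))
    ≡ l * n + (57 * n + (19 + x))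
  collect = solve-∀
  total : ∀ l x → l * x + (57 * x + (19 * x + 100 * (8 * x))) + (7 * (l * x) + 724 * x) ≡ (200 + l) * 8 * x
  total = solve-∀

-- The 4 is the rounding constant of `length-interval`, absorbed by `n ≥ 1`.
3n+4≤7n : ∀ {n} → 0 ℕ.< n → 3 * n + 4 ≤ 7 * n
3n+4≤7n {n} 0<n = ℕ.≤-trans (ℕ.+-monoʳ-≤ (3 * n) (ℕ.*-monoʳ-≤ 4 0<n))
  (ℕ.≤-reflexive (sym (ℕ.*-distribʳ-+ n 3 4)))

-- The subroutines of algorithmF2 are variables so that costs are compared without
-- unfolding them, which would be exponential in the nesting.
scaling-cost : ∀ {k n r p s q} (d : ℤ × ℤ → ℕ) (run : Timed (Subset k)) (round : Timed A) (profit : A → Timed ℤ)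
  (scaled : ℚ → Timed B) (range : ℚ → ℤ → Timed (ℤ × ℤ)) (solve : B → ℤ → ℤ → Timed (Subset k)) ε →
  cost run ≡ cost (round >>= λ S → profit S >>= λ LB →
    op₂ ℤ._*_ (ℤ.+ 3) LB >>= λ UB →
    op₂ ℚ._*_ ε (fromℤ LB) >>= λ εLB →
    op₂ _÷₀_ εLB (fromℕ n) >>= λ step →
    scaled step >>= λ p̂ →
    range step UB >>= λ (z-min , z-max) →
    solve p̂ z-min z-max) →
  cost round ≤ r → (∀ S → cost (profit S) ≤ p) → (∀ step → cost (scaled step) ≤ s) →
  (∀ step UB → cost (range step UB) ≤ q) → (∀ p̂ lo hi → cost (solve p̂ lo hi) ≤ d (lo , hi)) →
  let LB = value (profit (value round)) in
  cost run ≤ r + (p + (3 + (s + (q + d (value (range ((ε ℚ.* fromℤ LB) ÷₀ fromℕ n) (ℤ.+ 3 ℤ.* LB)))))))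
scaling-cost d run round profit scaled range solve ε run≡ round≤ profit≤ scaled≤ range≤ solve≤ =
  ℕ.≤-trans (ℕ.≤-reflexive run≡)
    (ℕ.+-mono-≤ round≤ (ℕ.+-mono-≤ (profit≤ _) (ℕ.+-monoʳ-≤ 3
      (ℕ.+-mono-≤ (scaled≤ _) (ℕ.+-mono-≤ (range≤ _ _) (solve≤ _ _ _))))))

-- The successor matches `Z` in the bound for the dynamic program and keeps the count positive for
-- an empty interval.
levelCount : ℤ × ℤ → ℕ
levelCount (lo , hi) = suc (length (interval lo hi))

-- Replaces the condition by a known one without abstracting over it in the unfolded algorithm.
value-if : ∀ {c d} → c ≡ d → (t u : Timed A) → value (if c then t else u) ≡ value (if d then t else u)
value-if refl t u = refl

module _ (lp : LPSolver) (I : Instance) (ε : ℚ) where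
  open Instance I
  open F2 lp I ε

  profitRange-nonneg : value allNonnegative ≡ true → ∀ step UB →
    value (profitRange step UB) ≡ (0ℤ , ℚ.ceiling (fromℤ UB ÷₀ step))
  profitRange-nonneg nonneg step UB = value-if nonneg _ _

  profitRange-arbitrary : value allNonnegative ≡ false → ∀ step UB →
    let npmax = ℤ.+ n ℤ.* value maxProfit in
    value (profitRange step UB) ≡
    (ℚ.floor (fromℤ (ℤ.- npmax) ÷₀ step) , ℚ.ceiling (fromℤ (UB ℤ.+ npmax) ÷₀ step))
  profitRange-arbitrary ¬nonneg step UB = value-if ¬nonneg _ _

module _ {ε LB n} (0<ε : 0ℚ ℚ.< ε) (ε<1 : ε ℚ.< 1ℚ) (0<LB : 0ℤ ℤ.< LB) (0<n : 0 ℕ.< n) where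
  private
    UB : ℤ
    UB = ℤ.+ 3 ℤ.* LB

    step : ℚ
    step = (ε ℚ.* fromℤ LB) ÷₀ fromℕ n

    0<step : 0ℚ ℚ.< step
    0<step = ÷₀-pos (*-pos 0<ε (fromℤ-mono-< 0<LB)) (fromℤ-mono-< (ℤ.+<+ 0<n))

  levels-nonneg : fromℕ (levelCount (0ℤ , ℚ.ceiling (fromℤ UB ÷₀ step))) ℚ.* ε ℚ.≤ fromℕ (3 * n + 4)
  levels-nonneg = length-interval {lo = 0ℤ} {hi = ℚ.ceiling q′} {k = 3 * n} 0ℚ q′ 0<ε ε<1
    (ℚ.<⇒≤ (ℚ.positive⁻¹ 1ℚ)) (⌈p⌉≤p+1 q′) (scaled-gap {k = 3} (q′ ℚ.- 0ℚ) 0<ε 0<LB 0<n (begin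
      (q′ ℚ.- 0ℚ) ℚ.* step      ≡⟨ cong (ℚ._* step) (ℚ.+-identityʳ q′) ⟩
      q′ ℚ.* step               ≡⟨ ÷₀-* (fromℤ UB) 0<step ⟩
      fromℤ UB                  ≡⟨ fromℤ-homo-* (ℤ.+ 3) LB ⟩
      fromℕ 3 ℚ.* fromℤ LB      ∎))
    where
    open ℚ.≤-Reasoning
    q′ = fromℤ UB ÷₀ step

  levels-arbitrary : ∀ p → p ℤ.≤ LB →
    fromℕ (levelCount (ℚ.floor (fromℤ (ℤ.- (ℤ.+ n ℤ.* p)) ÷₀ step) , ℚ.ceiling (fromℤ (UB ℤ.+ ℤ.+ n ℤ.* p) ÷₀ step))) ℚ.* ε
    ℚ.≤ fromℕ ((3 + 2 * n) * n + 4)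
  levels-arbitrary p p≤LB =
    length-interval {lo = ℚ.floor q} {hi = ℚ.ceiling q′} {k = (3 + 2 * n) * n} q q′ 0<ε ε<1
      (p≤⌊p⌋+1 q) (⌈p⌉≤p+1 q′) (scaled-gap {k = 3 + 2 * n} (q′ ℚ.- q) 0<ε 0<LB 0<n (begin
        (q′ ℚ.- q) ℚ.* step                              ≡⟨ solve 3 (λ q′ q s → (q′ :- q) :* s := q′ :* s :- q :* s) refl q′ q step ⟩
        q′ ℚ.* step ℚ.- q ℚ.* step                       ≡⟨ cong₂ ℚ._-_ (÷₀-* (fromℤ (UB ℤ.+ np)) 0<step) (÷₀-* (fromℤ (ℤ.- np)) 0<step) ⟩
        fromℤ (UB ℤ.+ np) ℚ.- fromℤ (ℤ.- np)             ≡⟨ cong (fromℤ (UB ℤ.+ np) ℚ.+_) (fromℤ-homo-neg (ℤ.- np)) ⟨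
        fromℤ (UB ℤ.+ np) ℚ.+ fromℤ (ℤ.- ℤ.- np)         ≡⟨ cong (λ z → fromℤ (UB ℤ.+ np) ℚ.+ fromℤ z) (ℤ.neg-involutive np) ⟩
        fromℤ (UB ℤ.+ np) ℚ.+ fromℤ np                   ≡⟨ fromℤ-homo-+ (UB ℤ.+ np) np ⟨
        -- Replacing `p` by `LB` makes the length of the range a multiple of `LB`, with factor
        -- `3 + 2 n`, as `scaled-gap` requires.
        fromℤ (UB ℤ.+ np ℤ.+ np)                         ≤⟨ fromℤ-mono-≤ (ℤ.+-mono-≤ (ℤ.+-monoʳ-≤ UB np≤) np≤) ⟩
        fromℤ (UB ℤ.+ nLB ℤ.+ nLB)                       ≡⟨ cong fromℤ (collect LB (ℤ.+ n)) ⟩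
        fromℤ ((ℤ.+ 3 ℤ.+ ℤ.+ 2 ℤ.* ℤ.+ n) ℤ.* LB)       ≡⟨ cong (λ z → fromℤ ((ℤ.+ 3 ℤ.+ z) ℤ.* LB)) (ℤ.pos-* 2 n) ⟨
        fromℤ (ℤ.+ (3 + 2 * n) ℤ.* LB)                   ≡⟨ fromℤ-homo-* (ℤ.+ (3 + 2 * n)) LB ⟩
        fromℕ (3 + 2 * n) ℚ.* fromℤ LB                   ∎))
    where
    open ℚ.≤-Reasoning
    open +-*-Solver using (solve; _:*_; _:-_; _:=_)
    np nLB : ℤ
    np = ℤ.+ n ℤ.* p
    nLB = ℤ.+ n ℤ.* LB
    q q′ : ℚ
    q = fromℤ (ℤ.- np) ÷₀ step
    q′ = fromℤ (UB ℤ.+ np) ÷₀ step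
    np≤ : np ℤ.≤ nLB
    np≤ = ℤ.*-monoˡ-≤-nonNeg (ℤ.+ n) p≤LB
    collect : ∀ l n → ℤ.+ 3 ℤ.* l ℤ.+ n ℤ.* l ℤ.+ n ℤ.* l ≡ (ℤ.+ 3 ℤ.+ ℤ.+ 2 ℤ.* n) ℤ.* l
    collect = ℤSolver.solve-∀

module _ (lp : LPSolver) (I : Instance) (ε : ℚ) where
  open Instance I
  open F2 lp I ε

  range : ℤ → ℤ × ℤ
  range LB = value (profitRange ((ε ℚ.* fromℤ LB) ÷₀ fromℕ n) (ℤ.+ 3 ℤ.* LB))

  module _ {LB} (0<ε : 0ℚ ℚ.< ε) (ε<1 : ε ℚ.< 1ℚ) (0<LB : 0ℤ ℤ.< LB) (0<n : 0 ℕ.< n) where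
    range-nonneg : value allNonnegative ≡ true → ∀ {b} → 3 * n + 4 ≤ b →
      fromℕ (levelCount (range LB)) ℚ.* ε ℚ.≤ fromℕ b
    range-nonneg nonneg {b} ≤b = subst (λ r → fromℕ (levelCount r) ℚ.* ε ℚ.≤ fromℕ b)
      (sym (profitRange-nonneg lp I ε nonneg ((ε ℚ.* fromℤ LB) ÷₀ fromℕ n) (ℤ.+ 3 ℤ.* LB)))
      (ℚ.≤-trans (levels-nonneg 0<ε ε<1 0<LB 0<n) (fromℕ-mono-≤ ≤b))

    range-arbitrary : value allNonnegative ≡ false → value maxProfit ℤ.≤ LB →
      ∀ {b} → (3 + 2 * n) * n + 4 ≤ b → fromℕ (levelCount (range LB)) ℚ.* ε ℚ.≤ fromℕ b
    range-arbitrary ¬nonneg pmax≤LB {b} ≤b = subst (λ r → fromℕ (levelCount r) ℚ.* ε ℚ.≤ fromℕ b)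
      (sym (profitRange-arbitrary lp I ε ¬nonneg ((ε ℚ.* fromℤ LB) ÷₀ fromℕ n) (ℤ.+ 3 ℤ.* LB)))
      (ℚ.≤-trans (levels-arbitrary 0<ε ε<1 0<LB 0<n (value maxProfit) pmax≤LB) (fromℕ-mono-≤ ≤b))

module _ {I : Instance} (adm : Admissible I) where
  open Instance I
  open Admissible adm
  open Sets I

  -- Choosing an item from each class is injective, because the chosen item determines its color.
  m≤n : m ≤ n
  m≤n = Fin.injective⇒≤ {f = λ c → proj₁ (classNonempty c)} λ {c} {c′} same →
    trans (sym (proj₂ (classNonempty c))) (trans (cong κ same) (proj₂ (classNonempty c′)))

  0<n : 0 ℕ.< n
  0<n = nonempty (proj₁ pmaxAttained)
    where
    nonempty : ∀ {n} → Fin n → 0 ℕ.< n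
    nonempty Fin.zero    = s≤s z≤n
    nonempty (Fin.suc _) = s≤s z≤n

  module _ (lp : LPSolver) (ε : ℚ) where
    open LPRound lp I
    open F2 lp I ε

    lowerBound : ℤ
    lowerBound = value (profit (value lpRound))

    private
      r : Fin n
      r = proj₁ (mostProfitableItem-max I (proj₁ pmaxAttained))

      best≡ : value mostProfitableItem ≡ just (r , p r)
      best≡ = proj₁ (proj₂ (mostProfitableItem-max I (proj₁ pmaxAttained)))

    maxProfit≤lowerBound : value maxProfit ℤ.≤ lowerBound
    maxProfit≤lowerBound = ℤ.≤-trans (ℤ.≤-reflexive (maxProfit-max I lp ε best≡)) (p≤profit-lpRound I lp best≡)

    0<lowerBound : 0ℤ ℤ.< lowerBound
    0<lowerBound = ℤ.<-≤-trans pmax>0 (ℤ.≤-trans (ℤ.≤-reflexive (sym (proj₂ pmaxAttained)))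
      (ℤ.≤-trans (proj₂ (proj₂ (mostProfitableItem-max I (proj₁ pmaxAttained))) _) (p≤profit-lpRound I lp best≡)))

    runningTime≤ : ∀ {L} → cost (lp I) ≤ L * n → let Z = levelCount (range lp I ε lowerBound) in
      runningTime lp I ε ≤ (200 + L) * 8 * (n * (n * n)) * (Z * Z)
    runningTime≤ {L} lp≤ = total-cost≤ {n} {m} {L} {levelCount (range lp I ε lowerBound)} 0<n (s≤s z≤n) m≤n lp≤ refl
      (subroutines-cost (λ r → 100 * (suc n * (suc n * levelCount r) * (suc n * levelCount r)))
        (λ p̂ lo hi → dynamicProgram-cost I p̂ lo hi m≤n))
      where
      subroutines-cost : (d : ℤ × ℤ → ℕ) → (∀ p̂ lo hi → cost (Programs.dynamicProgram I p̂ lo hi) ≤ d (lo , hi)) →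
        runningTime lp I ε ≤
        cost (lp I) + (n + n * 4 + (m + n * 6 + (m * 5 + suc (n * 3 + (3 + (n * 8 + 2)))) + (n * 5 + suc (n * 4 + suc n))))
          + (n * 4 + (3 + (n + n * 5 + (n * 4 + (n * 5 + 1 + 7) + d (range lp I ε lowerBound)))))
      subroutines-cost d = scaling-cost {n = Instance.n I} d
        (F2.algorithmF2 lp I ε) lpRound (Sets.profit I) scaledProfits profitRange (Programs.dynamicProgram I) ε refl
        (lpRound-cost I lp) (profit-cost I) (scaledProfits-cost I lp ε) (profitRange-cost I lp ε)

    module _ (0<ε : 0ℚ ℚ.< ε) (ε<1 : ε ℚ.< 1ℚ) {K}
             (runningTime≤K : runningTime lp I ε ≤ K * (n * (n * n)) *
               (levelCount (range lp I ε lowerBound) * levelCount (range lp I ε lowerBound))) where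

      -- 49 is the square of the 7 in the level bound `7 n`.
      runningTime-nonneg : (∀ i → 0ℤ ℤ.≤ p i) →
        fromℕ (runningTime lp I ε) ℚ.≤ fromℕ (K * 49 * n ℕ.^ 5) ÷₀ (ε ℚ.* ε)
      runningTime-nonneg p≥0 =
        quadratic-bound {t = runningTime lp I ε} {levelCount (range lp I ε lowerBound)} (K * (n * (n * n)))
          {7 * n} {K * 49 * n ℕ.^ 5} 0<ε runningTime≤K
          (range-nonneg lp I ε {lowerBound} 0<ε ε<1 0<lowerBound 0<n (allNonnegative-true I lp ε p≥0) {7 * n} (3n+4≤7n 0<n))
          (ℕ.≤-reflexive (fifthPower K n))
        where
        fifthPower : ∀ k n → k * (n * (n * n)) * (7 * n * (7 * n)) ≡ k * 49 * (n * (n * (n * (n * (n * 1)))))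
        fifthPower = solve-∀

      -- 81 is the square of 9 = 3 + 2 + 4, obtained by raising every term of `3 n + 2 n² + 4` to
      -- order `n²`.
      runningTime-arbitrary : fromℕ (runningTime lp I ε) ℚ.≤ fromℕ (K * 81 * n ℕ.^ 7) ÷₀ (ε ℚ.* ε)
      runningTime-arbitrary =
        quadratic-bound {t = runningTime lp I ε} {levelCount (range lp I ε lowerBound)} (K * (n * (n * n)))
          {9 * (n * n)} {K * 81 * n ℕ.^ 7} 0<ε runningTime≤K
          (range≤ _ refl)
          (ℕ.≤-reflexive (seventhPower K n))
        where
        seventhPower : ∀ k n → k * (n * (n * n)) * (9 * (n * n) * (9 * (n * n))) ≡
                               k * 81 * (n * (n * (n * (n * (n * (n * (n * 1)))))))
        seventhPower = solve-∀
        n≤n² : n ≤ n * n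
        n≤n² = ℕ.m≤m*n n n ⦃ ℕ.>-nonZero 0<n ⦄
        quadratic : (3 + 2 * n) * n + 4 ≤ 9 * (n * n)
        quadratic = begin
          (3 + 2 * n) * n + 4                      ≡⟨ expand n ⟩
          3 * n + 2 * (n * n) + 4                  ≤⟨ ℕ.+-mono-≤ (ℕ.+-monoˡ-≤ (2 * (n * n)) (ℕ.*-monoʳ-≤ 3 n≤n²)) (ℕ.*-monoʳ-≤ 4 (ℕ.≤-trans 0<n n≤n²)) ⟩
          3 * (n * n) + 2 * (n * n) + 4 * (n * n)  ≡⟨ total (n * n) ⟩
          9 * (n * n)                              ∎
          where
          open ℕ.≤-Reasoning
          expand : ∀ n → (3 + 2 * n) * n + 4 ≡ 3 * n + 2 * (n * n) + 4
          expand = solve-∀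
          total : ∀ x → 3 * x + 2 * x + 4 * x ≡ 9 * x
          total = solve-∀
        -- Arbitrary profits include nonnegative ones, for which the algorithm takes the shorter
        -- range; both outcomes of its sign test have to fit below `9 n²`.
        range≤ : ∀ c → value allNonnegative ≡ c →
                 fromℕ (levelCount (range lp I ε lowerBound)) ℚ.* ε ℚ.≤ fromℕ (9 * (n * n))
        range≤ true  nonneg = range-nonneg lp I ε {lowerBound} 0<ε ε<1 0<lowerBound 0<n nonneg {9 * (n * n)}
          (ℕ.≤-trans (3n+4≤7n 0<n) (ℕ.≤-trans (ℕ.*-monoʳ-≤ 7 n≤n²) (ℕ.*-monoˡ-≤ (n * n) (ℕ.m≤m+n 7 2))))
        range≤ false ¬nonneg = range-arbitrary lp I ε {lowerBound} 0<ε ε<1 0<lowerBound 0<n ¬nonneg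
          maxProfit≤lowerBound {9 * (n * n)} quadratic

theorem6p3 :
  (lp : LPSolver) → IsLinearTimeLPSolver lp →
  (∃ λ (C : ℕ) → (I : Instance) → Admissible I →
     (ε : ℚ) → 0ℚ ℚ.< ε → ε ℚ.< 1ℚ →
     (∀ i → 0ℤ ℤ.≤ Instance.p I i) →
     fromℕ (runningTime lp I ε) ℚ.≤ fromℕ (C ℕ.* Instance.n I ℕ.^ 5) ÷₀ (ε ℚ.* ε))
  ×
  (∃ λ (C : ℕ) → (I : Instance) → Admissible I →
     (ε : ℚ) → 0ℚ ℚ.< ε → ε ℚ.< 1ℚ →
     fromℕ (runningTime lp I ε) ℚ.≤ fromℕ (C ℕ.* Instance.n I ℕ.^ 7) ÷₀ (ε ℚ.* ε))
theorem6p3 lp solver =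
  -- Both constants depend only on the linear-time constant `L` of the solver, so they are uniform
  -- in the instance and in `ε`.
  ((200 + L) * 8 * 49 , λ I adm ε 0<ε ε<1 → runningTime-nonneg adm lp ε 0<ε ε<1 {(200 + L) * 8} (runningTime≤ adm lp ε {L} (linear I adm))) ,
  ((200 + L) * 8 * 81 , λ I adm ε 0<ε ε<1 → runningTime-arbitrary adm lp ε 0<ε ε<1 {(200 + L) * 8} (runningTime≤ adm lp ε {L} (linear I adm)))
  where
  L = proj₁ (IsLinearTimeLPSolver.linear solver)
  linear = proj₂ (IsLinearTimeLPSolver.linear solver)
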